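{- Let $l,m,n$ be positive integers, let $f_{11}(x),\dots,f_{1l}(x),f_{21}(x),\dots,f_{2m}(x),g_1(x),\dots,g_n(x)\in\mathbb{Z}[x]$, and let $\alpha_1,\dots,\alpha_l,\beta_1,\dots,\beta_m,\gamma_1,\dots,\gamma_n$ be positive integers. Let $$f(x)=f_{11}(x)^{\alpha_1}f_{12}(x)^{\alpha_2}\cdots f_{1l}(x)^{\alpha_l}\pm f_{21}(x)^{\beta_1}f_{22}(x)^{\beta_2}\cdots f_{2m}(x)^{\beta_m}$$ (with either choice of sign) and $$g(y)=g_1(y)^{\gamma_1}g_2(y)^{\gamma_2}\cdots g_n(y)^{\gamma_n}.$$ Suppose that: (1) $\deg g(y)<\deg f(x)$; (2) $\deg g(y)>1+\deg\bigl(f_{11}(x)f_{12}(x)\cdots f_{1l}(x)\,f_{21}(x)\cdots f_{2m}(x)\,g_1(x)\cdots g_n(x)\bigr)$; (3) $f_{11}(x)f_{12}(x)\cdots f_{1l}(x)$ and $f_{21}(x)\cdots f_{2m}(x)$ have no common factor in $\mathbb{Z}[x]$ (other than the units $\pm1$); (4) the leading coefficient of each of the products $f_{11}(x)\cdots f_{1l}(x)$, $f_{21}(x)\cdots f_{2m}(x)$, $g_1(x)\cdots g_n(x)$ is positive. If the $ABC$-Conjecture is assumed, then the equation $f(x)=g(y)$ has finitely many solutions $(x,y)$ in integers.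
   Context: The $ABC$-Conjecture is the following assertion: for every fixed $\epsilon>0$ there is a constant $C_\epsilon$ such that, whenever $a,b,c$ are coprime positive integers with $a+b=c$, one has $c\le C_\epsilon\,N(a,b,c)^{1+\epsilon}$, where $N(a,b,c)$ is the product of the distinct prime divisors of $abc$. -}

module Defs where

open import Algebra.Bundles.Raw using (RawRing)
import Algebra.Definitions.RawSemiring as RawSemiringDefinitions
open import Data.Integer.Base as ℤ using (ℤ; 0ℤ; 1ℤ; ∣_∣)
import Data.Integer.Properties as ℤ
open import Data.List.Base using (List; []; _∷_; [_]; map; length; filter; upTo)
open import Data.Nat.Base as ℕ using (ℕ; zero; suc; pred)
open import Data.Nat.Divisibility using (_∣?_)
open import Data.Nat.GCD using (gcd)
open import Data.Nat.ListAction using () renaming (product to productℕ)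
open import Data.Nat.Primality using (prime?)
open import Data.Product.Base using (∃-syntax)
open import Data.Rational.Base as ℚ using (ℚ; 0ℚ; ↥_; ↧ₙ_)
open import Data.Sign.Base using (Sign)
open import Data.Vec.Functional using (Vector)
open import Level using (0ℓ)
open import Relation.Binary.PropositionalEquality.Core using (_≡_)
open import Relation.Nullary.Decidable.Core using (yes; no; _×-dec_)

-- A polynomial is its list of coefficients, constant term first. Trailing
-- zeros are allowed, so equality of polynomials is _≈_ and not _≡_.

ℤ[x] : Set
ℤ[x] = List ℤ

coeff : ℤ[x] → ℕ → ℤ
coeff []      i       = 0ℤ
coeff (a ∷ p) zero    = a
coeff (a ∷ p) (suc i) = coeff p i

infix 4 _≈_
_≈_ : ℤ[x] → ℤ[x] → Set
p ≈ q = ∀ i → coeff p i ≡ coeff q i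

infixl 6 _+_ _-_
infixl 7 _*_
infix  8 -_

_+_ : ℤ[x] → ℤ[x] → ℤ[x]
[]      + q       = q
(a ∷ p) + []      = a ∷ p
(a ∷ p) + (b ∷ q) = a ℤ.+ b ∷ p + q

-_ : ℤ[x] → ℤ[x]
- p = map ℤ.-_ p

_-_ : ℤ[x] → ℤ[x] → ℤ[x]
p - q = p + (- q)

_*_ : ℤ[x] → ℤ[x] → ℤ[x]
[]      * q = []
(a ∷ p) * q = map (a ℤ.*_) q + (0ℤ ∷ p * q)

ℤ[x]-rawRing : RawRing 0ℓ 0ℓ
ℤ[x]-rawRing = record
  { Carrier = ℤ[x]
  ; _≈_     = _≈_
  ; _+_     = _+_
  ; _*_     = _*_
  ; -_      = -_
  ; 0#      = []
  ; 1#      = [ 1ℤ ]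
  }

-- Coprime p q says that every common divisor of p and q in ℤ[x] divides 1.
open RawSemiringDefinitions (RawRing.rawSemiring ℤ[x]-rawRing) public
  using (_^_; product; Coprime)

eval : ℤ[x] → ℤ → ℤ
eval []      x = 0ℤ
eval (a ∷ p) x = a ℤ.+ x ℤ.* eval p x

consTrimmed : ℤ → ℤ[x] → ℤ[x]
consTrimmed a (b ∷ p) = a ∷ b ∷ p
consTrimmed a []      with a ℤ.≟ 0ℤ
... | yes _ = []
... | no  _ = [ a ]

trim : ℤ[x] → ℤ[x]
trim []      = []
trim (a ∷ p) = consTrimmed a (trim p)

-- The zero polynomial gets degree 0 and leading coefficient 0. So a positive
-- leading coefficient, or a bound d < deg p with d : ℕ, implies p ≉ 0.

deg : ℤ[x] → ℕ
deg p = pred (length (trim p))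

leadingCoeff : ℤ[x] → ℤ
leadingCoeff p = coeff p (deg p)

powerProduct : ∀ {k} → Vector ℤ[x] k → Vector ℕ k → ℤ[x]
powerProduct f α = product (λ i → f i ^ α i)

infixl 6 _±[_]_
_±[_]_ : ℤ[x] → Sign → ℤ[x] → ℤ[x]
p ±[ Sign.+ ] q = p + q
p ±[ Sign.- ] q = p - q

-- The product of the distinct prime divisors of n, for n > 0.

rad : ℕ → ℕ
rad n = productℕ (filter (λ p → prime? p ×-dec (p ∣? n)) (upTo (suc n)))

-- For ε = r / s in lowest terms, c ≤ C N^(1+ε) is written with both sides
-- raised to the power s. Since N ≥ 1, N^(1+ε) is monotone in ε, so rational ε
-- suffice; and C may be rounded up to a natural number.

ABC-Conjecture : Set
ABC-Conjecture =
  ∀ (ε : ℚ) → 0ℚ ℚ.< ε →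
  ∃[ C ] ∀ (a b c : ℕ) → 0 ℕ.< a → 0 ℕ.< b → 0 ℕ.< c →
    gcd (gcd a b) c ≡ 1 → a ℕ.+ b ≡ c →
    let r = ∣ ↥ ε ∣
        s = ↧ₙ ε
    in c ℕ.^ s ℕ.≤ C ℕ.^ s ℕ.* rad (a ℕ.* b ℕ.* c) ℕ.^ (s ℕ.+ r)

{-# OPTIONS --safe #-}

-- Write P, Q, G for the products of the f₁ᵢ, the f₂ⱼ and the gₖ, and A ± B = g(y) for the equation.
-- A Bézout identity U P + V Q = R in ℤ[x] with R ≠ 0 constant bounds gcd(A(x), B(x)) independently
-- of x, since A and B divide powers of P and Q. Dividing the equation by this gcd and applying the
-- ABC-Conjecture with ε = 1 / deg g gives
--   |g(y)|^(deg g) ≤ const · |P(x) Q(x) G(y)|^(deg g + 1),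
-- as every prime divisor of A(x) B(x) g(y) divides P(x) Q(x) G(y). For large |y|, deg g < deg f
-- forces |x| ≤ |y|, so the right side is at most const · |y|^((deg g − 2)(deg g + 1)), while
-- |g(y)| ≥ |y|^(deg g − 1). Comparing exponents bounds |y|; the roots of P, Q and G are finite in
-- number, and each of x and y bounds the other.

module Submission where

open import Defs
open import Data.Empty using (⊥-elim)
import Data.Fin.Base as Fin
open import Data.Integer.Base as ℤ using (ℤ; 0ℤ; 1ℤ; +_; -[1+_]; ∣_∣)
import Data.Integer.Divisibility.Signed as ℤ
import Data.Integer.Properties as ℤ
open import Data.Integer.Tactic.RingSolver using (solve-∀)
open import Data.List.Base using (List; []; _∷_; [_]; map; length; upTo; _++_; cartesianProduct)
open import Data.List.Membership.Propositional using (_∈_)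
open import Data.List.Membership.Propositional.Properties
  using (∈-map⁺; ∈-++⁺ˡ; ∈-++⁺ʳ; ∈-upTo⁺; ∈-cartesianProduct⁺)
open import Data.List.Relation.Unary.All as All using (All; []; _∷_)
open import Data.List.Relation.Unary.All.Properties using (all-filter)
open import Data.List.Relation.Unary.AllPairs using ([]; _∷_)
open import Data.List.Relation.Unary.Unique.Propositional using (Unique)
open import Data.List.Relation.Unary.Unique.Propositional.Properties using (filter⁺; upTo⁺)
open import Data.Nat.Base as ℕ using (ℕ; zero; suc; z≤n; s≤s; pred)
open import Data.Nat.Coprimality using (1-coprimeTo)
import Data.Nat.Divisibility as ℕ
open import Data.Nat.GCD using (gcd; gcd[m,n]∣m; gcd[m,n]∣n; gcd-greatest)
open import Data.Nat.ListAction using () renaming (product to productℕ)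
open import Data.Nat.Primality using (Prime; prime?; euclidsLemma; prime⇒nonZero)
open import Data.Nat.Primality.Factorisation
  using (PrimeFactorisation; factorise; factorisationHasAllPrimeFactors)
import Data.Nat.Properties as ℕ
import Data.Nat.Tactic.RingSolver as ℕ
open import Data.Product.Base using (∃-syntax; _,_; _×_; proj₁; proj₂)
open import Data.Rational.Base as ℚ using (ℚ; 0ℚ; mkℚ)
open import Data.Sign.Base using (Sign)
open import Data.Sum.Base using (_⊎_; inj₁; inj₂; [_,_]′)
open import Data.Vec.Functional using (Vector; tail)
open import Relation.Binary.Definitions using (tri<; tri≈; tri>)
open import Relation.Binary.PropositionalEquality
  using (_≡_; refl; sym; trans; cong; cong₂; subst; subst₂)
open import Relation.Nullary using (Dec; ¬_; yes; no)
open import Relation.Nullary.Decidable using (_×-dec_)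

-- Evaluation and coefficients

eval-map : ∀ a p x → eval (map (a ℤ.*_) p) x ≡ a ℤ.* eval p x
eval-map a []      x = sym (ℤ.*-zeroʳ a)
eval-map a (b ∷ p) x rewrite eval-map a p x = identity a b x (eval p x)
  where
  identity : ∀ a b x u → a ℤ.* b ℤ.+ x ℤ.* (a ℤ.* u) ≡ a ℤ.* (b ℤ.+ x ℤ.* u)
  identity = solve-∀

eval-+ : ∀ p q x → eval (p + q) x ≡ eval p x ℤ.+ eval q x
eval-+ []      q       x = sym (ℤ.+-identityˡ _)
eval-+ (a ∷ p) []      x = sym (ℤ.+-identityʳ _)
eval-+ (a ∷ p) (b ∷ q) x rewrite eval-+ p q x = identity a b x (eval p x) (eval q x)
  where
  identity : ∀ a b x u v →
    a ℤ.+ b ℤ.+ x ℤ.* (u ℤ.+ v) ≡ (a ℤ.+ x ℤ.* u) ℤ.+ (b ℤ.+ x ℤ.* v)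
  identity = solve-∀

eval-neg : ∀ p x → eval (- p) x ≡ ℤ.- eval p x
eval-neg []      x = refl
eval-neg (a ∷ p) x rewrite eval-neg p x = identity a x (eval p x)
  where
  identity : ∀ a x u → ℤ.- a ℤ.+ x ℤ.* (ℤ.- u) ≡ ℤ.- (a ℤ.+ x ℤ.* u)
  identity = solve-∀

eval-- : ∀ p q x → eval (p - q) x ≡ eval p x ℤ.- eval q x
eval-- p q x = trans (eval-+ p (- q) x) (cong (λ u → eval p x ℤ.+ u) (eval-neg q x))

eval-* : ∀ p q x → eval (p * q) x ≡ eval p x ℤ.* eval q x
eval-* []      q x = refl
eval-* (a ∷ p) q x
  rewrite eval-+ (map (a ℤ.*_) q) (0ℤ ∷ p * q) x | eval-map a q x | eval-* p q x
  = identity a x (eval p x) (eval q x)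
  where
  identity : ∀ a x u v → a ℤ.* v ℤ.+ (0ℤ ℤ.+ x ℤ.* (u ℤ.* v)) ≡ (a ℤ.+ x ℤ.* u) ℤ.* v
  identity = solve-∀

eval-const : ∀ a x → eval [ a ] x ≡ a
eval-const a x = trans (cong (λ u → a ℤ.+ u) (ℤ.*-zeroʳ x)) (ℤ.+-identityʳ a)

eval-^ : ∀ p n x → eval (p ^ n) x ≡ eval p x ℤ.^ n
eval-^ p zero    x = eval-const 1ℤ x
eval-^ p (suc n) x = trans (eval-* p (p ^ n) x) (cong (eval p x ℤ.*_) (eval-^ p n x))

eval-cong : ∀ {p q} → p ≈ q → ∀ x → eval p x ≡ eval q x
eval-cong {[]}    {[]}    eq x = refl
eval-cong {[]}    {b ∷ q} eq x =
  trans (sym (trans (ℤ.+-identityˡ (x ℤ.* 0ℤ)) (ℤ.*-zeroʳ x)))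
        (cong₂ (λ a u → a ℤ.+ x ℤ.* u) (eq 0) (eval-cong {[]} {q} (λ i → eq (suc i)) x))
eval-cong {a ∷ p} {[]}    eq x =
  trans (cong₂ (λ a u → a ℤ.+ x ℤ.* u) (eq 0) (eval-cong {p} {[]} (λ i → eq (suc i)) x))
        (trans (ℤ.+-identityˡ (x ℤ.* 0ℤ)) (ℤ.*-zeroʳ x))
eval-cong {a ∷ p} {b ∷ q} eq x =
  cong₂ (λ a u → a ℤ.+ x ℤ.* u) (eq 0) (eval-cong {p} {q} (λ i → eq (suc i)) x)

coeff-+ : ∀ p q i → coeff (p + q) i ≡ coeff p i ℤ.+ coeff q i
coeff-+ []      q       i       = sym (ℤ.+-identityˡ _)
coeff-+ (a ∷ p) []      i       = sym (ℤ.+-identityʳ _)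
coeff-+ (a ∷ p) (b ∷ q) zero    = refl
coeff-+ (a ∷ p) (b ∷ q) (suc i) = coeff-+ p q i

coeff-neg : ∀ p i → coeff (- p) i ≡ ℤ.- coeff p i
coeff-neg []      i       = refl
coeff-neg (a ∷ p) zero    = refl
coeff-neg (a ∷ p) (suc i) = coeff-neg p i

coeff-map : ∀ a p i → coeff (map (a ℤ.*_) p) i ≡ a ℤ.* coeff p i
coeff-map a []      i       = sym (ℤ.*-zeroʳ a)
coeff-map a (b ∷ p) zero    = refl
coeff-map a (b ∷ p) (suc i) = coeff-map a p i

coeff-- : ∀ p q i → coeff (p - q) i ≡ coeff p i ℤ.- coeff q i
coeff-- p q i = trans (coeff-+ p (- q) i) (cong (λ u → coeff p i ℤ.+ u) (coeff-neg q i))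

-- Degrees

-- As trailing zeros are allowed, `Below p 0` is how a list is said to represent the zero
-- polynomial, and `Below p n` that its degree is less than n.
Below : ℤ[x] → ℕ → Set
Below p n = ∀ {i} → n ℕ.≤ i → coeff p i ≡ 0ℤ

below-pred : ∀ {p m} → Below p (suc m) → coeff p m ≡ 0ℤ → Below p m
below-pred z c {i} m≤i with ℕ.m≤n⇒m<n∨m≡n m≤i
... | inj₁ m<i  = z m<i
... | inj₂ refl = c

-- Here a may be 0, so Top p d a bounds the degree of p by d without fixing it.
record Top (p : ℤ[x]) (d : ℕ) (a : ℤ) : Set where
  constructor top
  field
    coeff≡ : coeff p d ≡ a
    above  : Below p (suc d)

open Top

top-tail : ∀ {b p d a} → Top (b ∷ p) (suc d) a → Top p d a
top-tail (top c z) = top c (λ le → z (s≤s le))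

below0-* : ∀ p q → Below p 0 → Below (p * q) 0
below0-* []      q z _ = refl
below0-* (a ∷ p) q z {i} _
  rewrite coeff-+ (map (a ℤ.*_) q) (0ℤ ∷ p * q) i | coeff-map a q i | z {0} z≤n
  with i
... | zero  = refl
... | suc i = trans (ℤ.+-identityˡ _) (below0-* p q (λ {j} _ → z {suc j} z≤n) {i} z≤n)

-- Induction on the index d. For d = 0 the tail of the left factor is zero, and the product is c
-- times q. For a larger index `map (c ℤ.*_) q` no longer reaches the top, so only the shifted
-- product counts there.
top-* : ∀ {p q d e a b} → Top p d a → Top q e b → Top (p * q) (d ℕ.+ e) (a ℤ.* b)
top-* {[]}    {q} {a = a} {b} (top refl z) (top refl z′) = top refl (λ _ → refl)
top-* {c ∷ p} {q} {zero} {e} {a} {b} (top refl z) (top refl z′) = top (value e) λ {i} le → vanish i le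
  where
  rest : ∀ i → coeff (0ℤ ∷ p * q) i ≡ 0ℤ
  rest zero    = refl
  rest (suc i) = below0-* p q (λ {j} _ → z {suc j} (s≤s z≤n)) {i} z≤n

  value : ∀ i → coeff (map (c ℤ.*_) q + (0ℤ ∷ p * q)) i ≡ c ℤ.* coeff q i
  value i rewrite coeff-+ (map (c ℤ.*_) q) (0ℤ ∷ p * q) i | coeff-map c q i | rest i = ℤ.+-identityʳ _

  vanish : ∀ i → suc e ℕ.≤ i → coeff (map (c ℤ.*_) q + (0ℤ ∷ p * q)) i ≡ 0ℤ
  vanish i le = trans (value i) (trans (cong (c ℤ.*_) (z′ le)) (ℤ.*-zeroʳ c))
top-* {c ∷ p} {q} {suc d} {e} {a} {b} tp tq@(top _ z′) =
  top (trans (value (d ℕ.+ e) (s≤s (ℕ.m≤n+m e d))) (coeff≡ ih)) λ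
    { (s≤s le) → trans (value _ (s≤s (ℕ.≤-trans (ℕ.m≤n+m e d) (ℕ.<⇒≤ le)))) (above ih le) }
  where
  ih : Top (p * q) (d ℕ.+ e) (a ℤ.* b)
  ih = top-* (top-tail tp) tq

  value : ∀ i → suc e ℕ.≤ suc i → coeff (map (c ℤ.*_) q + (0ℤ ∷ p * q)) (suc i) ≡ coeff (p * q) i
  value i le rewrite coeff-+ (map (c ℤ.*_) q) (0ℤ ∷ p * q) (suc i) | coeff-map c q (suc i) | z′ le
    = trans (cong (ℤ._+ _) (ℤ.*-zeroʳ c)) (ℤ.+-identityˡ _)

top-const : ∀ a → Top [ a ] 0 a
top-const a = top refl λ { (s≤s _) → refl }

monomial : ℕ → ℤ → ℤ[x]
monomial zero    a = [ a ]
monomial (suc n) a = 0ℤ ∷ monomial n a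

top-monomial : ∀ n a → Top (monomial n a) n a
top-monomial zero    a = top-const a
top-monomial (suc n) a with top-monomial n a
... | top c z = top c λ { (s≤s le) → z le }

below⇒zero⊎top : ∀ {p} n → Below p n → Below p 0 ⊎ ∃[ d ] ∃[ a ] (¬ a ≡ 0ℤ × Top p d a)
below⇒zero⊎top zero z = inj₁ z
below⇒zero⊎top {p} (suc n) z with coeff p n ℤ.≟ 0ℤ
... | no  a≢0 = inj₂ (n , _ , a≢0 , top refl z)
... | yes a≡0 = below⇒zero⊎top {p} n (below-pred {p} z a≡0)

below-length : ∀ p → Below p (length p)
below-length []      _          = refl
below-length (a ∷ p) (s≤s le)   = below-length p le

zero⊎top : ∀ p → Below p 0 ⊎ ∃[ d ] ∃[ a ] (¬ a ≡ 0ℤ × Top p d a)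
zero⊎top p = below⇒zero⊎top (length p) (below-length p)

top-unique : ∀ {p d e a b} → ¬ a ≡ 0ℤ → ¬ b ≡ 0ℤ → Top p d a → Top p e b → d ≡ e
top-unique {d = d} {e} a≢0 b≢0 (top ca za) (top cb zb) with ℕ.<-cmp d e
... | tri< d<e _ _ = ⊥-elim (b≢0 (trans (sym cb) (za d<e)))
... | tri≈ _ eq _  = eq
... | tri> _ _ e<d = ⊥-elim (a≢0 (trans (sym ca) (zb e<d)))

coeff-consTrimmed : ∀ a p i → coeff (consTrimmed a p) i ≡ coeff (a ∷ p) i
coeff-consTrimmed a (b ∷ p) i = refl
coeff-consTrimmed a []      i with a ℤ.≟ 0ℤ
... | no  _    = refl
... | yes refl with i
...   | zero  = refl
...   | suc _ = refl

coeff-trim : ∀ p i → coeff (trim p) i ≡ coeff p i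
coeff-trim []      i = refl
coeff-trim (a ∷ p) zero = coeff-consTrimmed a (trim p) zero
coeff-trim (a ∷ p) (suc i) = trans (coeff-consTrimmed a (trim p) (suc i)) (coeff-trim p i)

top-deg : ∀ p → Top p (deg p) (leadingCoeff p)
top-deg p = top refl λ le → trans (sym (coeff-trim p _))
  (below-length (trim p) (ℕ.≤-trans (m≤1+pred (length (trim p))) le))
  where
  m≤1+pred : ∀ m → m ℕ.≤ suc (pred m)
  m≤1+pred zero    = z≤n
  m≤1+pred (suc m) = ℕ.≤-refl

length-consTrimmed : ∀ a p → length (consTrimmed a p) ℕ.≤ suc (length p)
length-consTrimmed a (b ∷ p) = ℕ.≤-refl
length-consTrimmed a [] with a ℤ.≟ 0ℤ
... | yes _ = z≤n
... | no  _ = ℕ.≤-refl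

below⇒length≤ : ∀ p n → Below p n → length (trim p) ℕ.≤ n
below⇒length≤ []      n       z = z≤n
below⇒length≤ (a ∷ p) (suc n) z =
  ℕ.≤-trans (length-consTrimmed a (trim p)) (s≤s (below⇒length≤ p n (λ le → z (s≤s le))))
below⇒length≤ (a ∷ p) zero    z
  with trim p | below⇒length≤ p 0 (λ {j} _ → z {suc j} z≤n)
... | [] | _ with a ℤ.≟ 0ℤ
...   | yes _   = z≤n
...   | no  a≢0 = ⊥-elim (a≢0 (z {0} z≤n))

-- If the leading coefficient were 0, the trimmed list would have length at most deg p, so that deg
-- p ≤ deg p - 1 in truncated subtraction. This is absurd for a positive degree, but not for the
-- zero polynomial.
leadingCoeff≢0 : ∀ p → 0 ℕ.< deg p → ¬ leadingCoeff p ≡ 0ℤ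
leadingCoeff≢0 p 0<deg lc≡0 = ℕ.<-irrefl refl
  (ℕ.≤-trans (ℕ.≤-reflexive (ℕ.suc-pred (deg p) {{ℕ.>-nonZero 0<deg}})) deg≤pred)
  where
  deg≤pred : deg p ℕ.≤ pred (deg p)
  deg≤pred = ℕ.pred-mono-≤ (below⇒length≤ p (deg p) (below-pred {p} (above (top-deg p)) lc≡0))

-- Growth

1≤∣_∣ : ∀ {a} → ¬ a ≡ 0ℤ → 1 ℕ.≤ ∣ a ∣
1≤∣ a≢0 ∣ = ℕ.n≢0⇒n>0 λ eq → a≢0 (ℤ.∣i∣≡0⇒i≡0 eq)

1≤^ : ∀ {w} d → 1 ℕ.≤ w → 1 ℕ.≤ w ℕ.^ d
1≤^ {w} d 1≤w = ℕ.m^n>0 w {{ℕ.>-nonZero 1≤w}} d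

eval-below0 : ∀ {p} → Below p 0 → ∀ x → eval p x ≡ 0ℤ
eval-below0 {p} z = eval-cong {p} {[]} (λ _ → z z≤n)

eval-top0 : ∀ {p a} → Top p 0 a → ∀ x → eval p x ≡ a
eval-top0 {p} {a} (top c z) x = trans (eval-cong {p} {[ a ]} eq x) (eval-const a x)
  where
  eq : p ≈ [ a ]
  eq zero    = c
  eq (suc i) = z (s≤s z≤n)

∣x∣*∣u∣≤ : ∀ a x u → ∣ x ∣ ℕ.* ∣ u ∣ ℕ.≤ ∣ a ℤ.+ x ℤ.* u ∣ ℕ.+ ∣ a ∣
∣x∣*∣u∣≤ a x u = subst (ℕ._≤ ∣ a ℤ.+ x ℤ.* u ∣ ℕ.+ ∣ a ∣) (trans (cong ∣_∣ (identity a (x ℤ.* u))) (ℤ.abs-* x u))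
  (ℤ.∣i-j∣≤∣i∣+∣j∣ (a ℤ.+ x ℤ.* u) a)
  where
  identity : ∀ a v → a ℤ.+ v ℤ.- a ≡ v
  identity = solve-∀

-- The factor m makes the induction go through: the constant term b is absorbed by asking m + |b| of
-- the tail.
lower-bound : ∀ {p d a} → ¬ a ≡ 0ℤ → Top p (suc d) a → ∀ m →
  ∃[ N ] (∀ x → N ℕ.≤ ∣ x ∣ → m ℕ.* ∣ x ∣ ℕ.^ d ℕ.≤ ∣ eval p x ∣)
lower-bound {[]} a≢0 (top c z) m = ⊥-elim (a≢0 (sym c))
lower-bound {b ∷ p} {zero} {a} a≢0 t m = m ℕ.+ ∣ b ∣ , λ x N≤x →
  ℕ.+-cancelʳ-≤ ∣ b ∣ _ _ (begin
    m ℕ.* 1 ℕ.+ ∣ b ∣                      ≡⟨ cong (ℕ._+ ∣ b ∣) (ℕ.*-identityʳ m) ⟩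
    m ℕ.+ ∣ b ∣                            ≤⟨ N≤x ⟩
    ∣ x ∣                                  ≡⟨ ℕ.*-identityʳ ∣ x ∣ ⟨
    ∣ x ∣ ℕ.* 1                            ≤⟨ ℕ.*-monoʳ-≤ ∣ x ∣ 1≤∣ a≢0 ∣ ⟩
    ∣ x ∣ ℕ.* ∣ a ∣                        ≡⟨ cong (λ u → ∣ x ∣ ℕ.* ∣ u ∣) (eval-top0 (top-tail t) x) ⟨
    ∣ x ∣ ℕ.* ∣ eval p x ∣                 ≤⟨ ∣x∣*∣u∣≤ b x (eval p x) ⟩
    ∣ b ℤ.+ x ℤ.* eval p x ∣ ℕ.+ ∣ b ∣     ∎)
  where open ℕ.≤-Reasoning
lower-bound {b ∷ p} {suc d} {a} a≢0 t m with lower-bound a≢0 (top-tail t) (m ℕ.+ ∣ b ∣)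
-- `suc N` forces |x| ≥ 1, hence |b| ≤ |b| |x|^(d + 1); here the surplus |b| in the factor for the
-- tail is spent.
... | N , bound = suc N , λ x N<x → ℕ.+-cancelʳ-≤ ∣ b ∣ _ _ (begin
    m ℕ.* ∣ x ∣ ℕ.^ suc d ℕ.+ ∣ b ∣
      ≡⟨ cong (λ k → m ℕ.* ∣ x ∣ ℕ.^ suc d ℕ.+ k) (ℕ.*-identityʳ ∣ b ∣) ⟨
    m ℕ.* ∣ x ∣ ℕ.^ suc d ℕ.+ ∣ b ∣ ℕ.* 1
      ≤⟨ ℕ.+-monoʳ-≤ (m ℕ.* ∣ x ∣ ℕ.^ suc d)
           (ℕ.*-monoʳ-≤ ∣ b ∣ (1≤^ (suc d) (ℕ.≤-trans (s≤s z≤n) N<x))) ⟩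
    m ℕ.* ∣ x ∣ ℕ.^ suc d ℕ.+ ∣ b ∣ ℕ.* ∣ x ∣ ℕ.^ suc d
      ≡⟨ identity m ∣ b ∣ ∣ x ∣ (∣ x ∣ ℕ.^ d) ⟩
    ∣ x ∣ ℕ.* ((m ℕ.+ ∣ b ∣) ℕ.* ∣ x ∣ ℕ.^ d)
      ≤⟨ ℕ.*-monoʳ-≤ ∣ x ∣ (bound x (ℕ.<⇒≤ N<x)) ⟩
    ∣ x ∣ ℕ.* ∣ eval p x ∣
      ≤⟨ ∣x∣*∣u∣≤ b x (eval p x) ⟩
    ∣ b ℤ.+ x ℤ.* eval p x ∣ ℕ.+ ∣ b ∣ ∎)
  where
  open ℕ.≤-Reasoning
  identity : ∀ m b x u → m ℕ.* (x ℕ.* u) ℕ.+ b ℕ.* (x ℕ.* u) ≡ x ℕ.* ((m ℕ.+ b) ℕ.* u)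
  identity = ℕ.solve-∀

-- The bound is in w and not in |x|, because polynomials in x are later estimated by powers of |y|,
-- and one in y by powers of |x|.
upper-bound : ∀ p d → Below p (suc d) →
  ∃[ H ] (∀ x w → ∣ x ∣ ℕ.≤ w → 1 ℕ.≤ w → ∣ eval p x ∣ ℕ.≤ H ℕ.* w ℕ.^ d)
upper-bound p zero z = ∣ coeff p 0 ∣ , λ x w _ _ →
  ℕ.≤-reflexive (trans (cong ∣_∣ (eval-top0 {p} (top refl z) x)) (sym (ℕ.*-identityʳ _)))
upper-bound []      (suc d) z = 0 , λ _ _ _ _ → z≤n
upper-bound (a ∷ p) (suc d) z with upper-bound p d (λ le → z (s≤s le))
... | H , bound = ∣ a ∣ ℕ.+ H , λ x w x≤w 1≤w → begin
    ∣ a ℤ.+ x ℤ.* eval p x ∣              ≤⟨ ℤ.∣i+j∣≤∣i∣+∣j∣ a (x ℤ.* eval p x) ⟩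
    ∣ a ∣ ℕ.+ ∣ x ℤ.* eval p x ∣          ≡⟨ cong₂ ℕ._+_ (sym (ℕ.*-identityʳ ∣ a ∣)) (ℤ.abs-* x (eval p x)) ⟩
    ∣ a ∣ ℕ.* 1 ℕ.+ ∣ x ∣ ℕ.* ∣ eval p x ∣
      ≤⟨ ℕ.+-mono-≤ (ℕ.*-monoʳ-≤ ∣ a ∣ (1≤^ (suc d) 1≤w)) (ℕ.*-mono-≤ x≤w (bound x w x≤w 1≤w)) ⟩
    ∣ a ∣ ℕ.* w ℕ.^ suc d ℕ.+ w ℕ.* (H ℕ.* w ℕ.^ d)
      ≡⟨ identity ∣ a ∣ H w (w ℕ.^ d) ⟩
    (∣ a ∣ ℕ.+ H) ℕ.* w ℕ.^ suc d ∎
  where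
  open ℕ.≤-Reasoning
  identity : ∀ a H w u → a ℕ.* (w ℕ.* u) ℕ.+ w ℕ.* (H ℕ.* u) ≡ (a ℕ.+ H) ℕ.* (w ℕ.* u)
  identity = ℕ.solve-∀

sublevel-bounded : ∀ {p d a} → ¬ a ≡ 0ℤ → Top p (suc d) a → ∀ T →
  ∃[ N ] (∀ x → ∣ eval p x ∣ ℕ.≤ T → ∣ x ∣ ℕ.≤ N)
sublevel-bounded {p} {d} a≢0 t T with lower-bound a≢0 t (suc T)
... | N , bound = N , λ x px≤T → ℕ.≮⇒≥ λ N<x → ℕ.<-irrefl refl (begin
    suc T                           ≡⟨ ℕ.*-identityʳ (suc T) ⟨
    suc T ℕ.* 1                     ≤⟨ ℕ.*-monoʳ-≤ (suc T) (1≤^ d (ℕ.≤-trans (s≤s z≤n) N<x)) ⟩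
    suc T ℕ.* ∣ x ∣ ℕ.^ d           ≤⟨ bound x (ℕ.<⇒≤ N<x) ⟩
    ∣ eval p x ∣                    ≤⟨ px≤T ⟩
    T                               ∎)
  where open ℕ.≤-Reasoning

roots-bounded : ∀ {p d a} → ¬ a ≡ 0ℤ → Top p d a → ∃[ N ] (∀ x → eval p x ≡ 0ℤ → ∣ x ∣ ℕ.≤ N)
roots-bounded {d = zero}  a≢0 t = 0 , λ x px≡0 → ⊥-elim (a≢0 (trans (sym (eval-top0 t x)) px≡0))
roots-bounded {d = suc d} a≢0 t with sublevel-bounded a≢0 t 0
... | N , bound = N , λ x px≡0 → bound x (ℕ.≤-reflexive (cong ∣_∣ px≡0))

-- Through this lemma polynomial identities are reduced to identities between integers.
eval-injective : ∀ {p q} → (∀ x → eval p x ≡ eval q x) → p ≈ q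
eval-injective {p} {q} eq with zero⊎top (p - q)
... | inj₁ z = λ i → ℤ.i-j≡0⇒i≡j _ _ (trans (sym (coeff-- p q i)) (z z≤n))
... | inj₂ (d , a , a≢0 , t) with roots-bounded a≢0 t
-- `p - q` vanishes at every integer, in particular at N + 1, which lies beyond the bound for its
-- roots.
...   | N , bound = ⊥-elim (ℕ.<-irrefl refl (bound (+ suc N)
        (trans (eval-- p q (+ suc N)) (ℤ.i≡j⇒i-j≡0 (eq (+ suc N))))))

-- Bézout identity for coprime polynomials

-- The outcome of Euclid's algorithm over the rationals with denominators cleared: `h` is the gcd up
-- to a constant, and `k` a common denominator of the cofactors. The identities are stated through
-- values, so that they reduce to ring identities between integers.
record PseudoGcd (P Q : ℤ[x]) : Set where
  field
    h U V p q : ℤ[x]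
    k         : ℤ
    k≢0       : ¬ k ≡ 0ℤ
    bézout    : ∀ x → eval h x ≡ eval U x ℤ.* eval P x ℤ.+ eval V x ℤ.* eval Q x
    h∣kP      : ∀ x → k ℤ.* eval P x ≡ eval p x ℤ.* eval h x
    h∣kQ      : ∀ x → k ℤ.* eval Q x ≡ eval q x ℤ.* eval h x

pseudoGcd-sym : ∀ {P Q} → PseudoGcd Q P → PseudoGcd P Q
pseudoGcd-sym G = record
  { h = h ; U = V ; V = U ; p = q ; q = p ; k = k ; k≢0 = k≢0
  ; bézout = λ x → trans (bézout x) (ℤ.+-comm (eval U x ℤ.* _) (eval V x ℤ.* _))
  ; h∣kP = h∣kQ ; h∣kQ = h∣kP }
  where open PseudoGcd G

pseudoGcd-zeroˡ : ∀ {P Q} → Below P 0 → PseudoGcd P Q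
pseudoGcd-zeroˡ {P} {Q} z = record
  { h = Q ; U = [] ; V = [ 1ℤ ] ; p = [] ; q = [ 1ℤ ] ; k = 1ℤ ; k≢0 = λ ()
  ; bézout = λ x → sym (trans (ℤ.+-identityˡ (eval [ 1ℤ ] x ℤ.* _)) (one x))
  ; h∣kP = λ x → trans (ℤ.*-identityˡ (eval P x)) (eval-below0 {P} z x)
  ; h∣kQ = λ x → trans (ℤ.*-identityˡ (eval Q x)) (sym (one x)) }
  where
  one : ∀ x → eval [ 1ℤ ] x ℤ.* eval Q x ≡ eval Q x
  one x = trans (cong (ℤ._* eval Q x) (eval-const 1ℤ x)) (ℤ.*-identityˡ (eval Q x))

-- One step of pseudo-division. For P' = b P - M Q, a combination of P' and Q is one of P and Q, and
-- b k P = k P' + M (k Q) shows that the denominator only picks up the factor b.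
pseudoGcd-reduceˡ : ∀ {P Q b} M → ¬ b ≡ 0ℤ → PseudoGcd ([ b ] * P - M * Q) Q → PseudoGcd P Q
pseudoGcd-reduceˡ {P} {Q} {b} M b≢0 G = record
  { h = h ; U = [ b ] * U ; V = V - U * M ; p = p + M * q ; q = [ b ] * q ; k = b ℤ.* k
  ; k≢0 = λ eq → [ b≢0 , k≢0 ]′ (ℤ.i*j≡0⇒i≡0∨j≡0 b eq)
  ; bézout = λ x → trans (bézout x) (bézout-step x)
  ; h∣kP = h∣kP-step
  ; h∣kQ = λ x → trans (ℤ.*-assoc b k (eval Q x))
      (trans (cong (b ℤ.*_) (h∣kQ x))
        (trans (sym (ℤ.*-assoc b (eval q x) (eval h x))) (cong (ℤ._* eval h x) (sym (scale q x))))) }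
  where
  open PseudoGcd G

  scale : ∀ r x → eval ([ b ] * r) x ≡ b ℤ.* eval r x
  scale r x = trans (eval-* [ b ] r x) (cong (ℤ._* eval r x) (eval-const b x))

  P′ : ∀ x → eval ([ b ] * P - M * Q) x ≡ b ℤ.* eval P x ℤ.- eval M x ℤ.* eval Q x
  P′ x = trans (eval-- ([ b ] * P) (M * Q) x) (cong₂ ℤ._-_ (scale P x) (eval-* M Q x))

  bézout-step : ∀ x → eval U x ℤ.* eval ([ b ] * P - M * Q) x ℤ.+ eval V x ℤ.* eval Q x
    ≡ eval ([ b ] * U) x ℤ.* eval P x ℤ.+ eval (V - U * M) x ℤ.* eval Q x
  bézout-step x
    rewrite P′ x | scale U x | eval-- V (U * M) x | eval-* U M x
    = identity b (eval U x) (eval V x) (eval M x) (eval P x) (eval Q x)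
    where
    identity : ∀ b u v m p q → u ℤ.* (b ℤ.* p ℤ.- m ℤ.* q) ℤ.+ v ℤ.* q
      ≡ (b ℤ.* u) ℤ.* p ℤ.+ (v ℤ.- u ℤ.* m) ℤ.* q
    identity = solve-∀

  h∣kP-step : ∀ x → b ℤ.* k ℤ.* eval P x ≡ eval (p + M * q) x ℤ.* eval h x
  h∣kP-step x = trans (identity b k (eval M x) (eval P x) (eval Q x))
    (trans (cong₂ (λ u v → u ℤ.+ eval M x ℤ.* v)
             (trans (cong (k ℤ.*_) (sym (P′ x))) (h∣kP x)) (h∣kQ x))
      (trans (identity′ (eval p x) (eval M x) (eval q x) (eval h x))
        (cong (ℤ._* eval h x) (sym (trans (eval-+ p (M * q) x)
          (cong (λ v → eval p x ℤ.+ v) (eval-* M q x)))))))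
    where
    identity : ∀ b k m p q → b ℤ.* k ℤ.* p ≡ k ℤ.* (b ℤ.* p ℤ.- m ℤ.* q) ℤ.+ m ℤ.* (k ℤ.* q)
    identity = solve-∀
    identity′ : ∀ p m q h → p ℤ.* h ℤ.+ m ℤ.* (q ℤ.* h) ≡ (p ℤ.+ m ℤ.* q) ℤ.* h
    identity′ = solve-∀

below-- : ∀ {P Q d a} → Top P d a → Top Q d a → Below (P - Q) d
below-- {P} {Q} {d} {a} (top c z) (top c′ z′) = below-pred {P - Q}
  (λ {i} le → trans (coeff-- P Q i) (cong₂ ℤ._-_ (z le) (z′ le)))
  (trans (coeff-- P Q d) (ℤ.i≡j⇒i-j≡0 (trans c (sym c′))))

-- Euclid's algorithm, one leading term at a time; the recursion runs on t, a bound for the sum of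
-- the two degree bounds. A coefficient 0 at the top just lowers a bound. Otherwise each polynomial
-- is scaled by the other's top coefficient, the shorter one also by a power of x, and the
-- difference loses its top term.
pseudoGcd-below : ∀ t {m n} P Q → m ℕ.+ n ℕ.≤ t → Below P m → Below Q n → PseudoGcd P Q
pseudoGcd-below t       {zero}          P Q le z z′ = pseudoGcd-zeroˡ z
pseudoGcd-below t       {suc m} {zero}  P Q le z z′ = pseudoGcd-sym (pseudoGcd-zeroˡ z′)
pseudoGcd-below (suc t) {suc m} {suc n} P Q (s≤s le) z z′ with coeff P m ℤ.≟ 0ℤ
... | yes c = pseudoGcd-below t P Q le (below-pred {P} z c) z′
... | no  a≢0 with coeff Q n ℤ.≟ 0ℤ
...   | yes c = pseudoGcd-below t P Q (ℕ.≤-trans (ℕ.≤-reflexive (sym (ℕ.+-suc m n))) le) z (below-pred {Q} z′ c)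
...   | no  b≢0 with ℕ.≤-total n m
...     | inj₁ n≤m = pseudoGcd-reduceˡ M b≢0
            (pseudoGcd-below t ([ coeff Q n ] * P - M * Q) Q le
              (below-- (top-* {q = P} (top-const (coeff Q n)) (top refl z))
                (subst₂ (Top (M * Q)) (ℕ.m∸n+n≡m n≤m) (ℤ.*-comm (coeff P m) (coeff Q n))
                  (top-* (top-monomial (m ℕ.∸ n) (coeff P m)) (top refl z′)))) z′)
  where M = monomial (m ℕ.∸ n) (coeff P m)
...     | inj₂ m≤n = pseudoGcd-sym (pseudoGcd-reduceˡ M a≢0
            (pseudoGcd-below t ([ coeff P m ] * Q - M * P) P
              (ℕ.≤-trans (ℕ.≤-reflexive (trans (ℕ.+-suc n m) (trans (cong suc (ℕ.+-comm n m)) (sym (ℕ.+-suc m n))))) le)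
              (below-- (top-* {q = Q} (top-const (coeff P m)) (top refl z′))
                (subst₂ (Top (M * P)) (ℕ.m∸n+n≡m m≤n) (ℤ.*-comm (coeff Q n) (coeff P m))
                  (top-* (top-monomial (n ℕ.∸ m) (coeff Q n)) (top refl z)))) z))
  where M = monomial (n ℕ.∸ m) (coeff Q n)

pseudoGcd : ∀ P Q → PseudoGcd P Q
pseudoGcd P Q = pseudoGcd-below (length P ℕ.+ length Q) P Q ℕ.≤-refl (below-length P) (below-length Q)

-- ᶜ for content.
infix 4 _∣ᶜ_
_∣ᶜ_ : ℤ → ℤ[x] → Set
r ∣ᶜ p = ∀ i → r ℤ.∣ coeff p i

∣ᶜ-quotient : ∀ {r} p → r ∣ᶜ p → ∃[ q ] (∀ x → eval p x ≡ r ℤ.* eval q x)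
∣ᶜ-quotient {r} []      _   = [] , λ _ → sym (ℤ.*-zeroʳ r)
∣ᶜ-quotient {r} (a ∷ p) r∣p with r∣p 0 | ∣ᶜ-quotient p (λ i → r∣p (suc i))
... | ℤ.divides s refl | q , eq = s ∷ q , λ x →
  trans (cong (λ u → s ℤ.* r ℤ.+ x ℤ.* u) (eq x)) (identity r s x (eval q x))
  where
  identity : ∀ r s x u → s ℤ.* r ℤ.+ x ℤ.* (r ℤ.* u) ≡ r ℤ.* (s ℤ.+ x ℤ.* u)
  identity = solve-∀

∣ᶜ-multiple : ∀ {r} p q → (∀ x → eval p x ≡ r ℤ.* eval q x) → r ∣ᶜ p
∣ᶜ-multiple {r} p q eq i = ℤ.divides (coeff q i)
  (trans (eval-injective {p} {map (r ℤ.*_) q} (λ x → trans (eq x) (sym (eval-map r q x))) i)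
    (trans (coeff-map r q i) (ℤ.*-comm r (coeff q i))))

-- Gauss's lemma and common divisors with integer coefficients

prime-∣-* : ∀ {r} → Prime r → ∀ a b → + r ℤ.∣ a ℤ.* b → + r ℤ.∣ a ⊎ + r ℤ.∣ b
prime-∣-* {r} pr a b r∣ab
  with euclidsLemma ∣ a ∣ ∣ b ∣ pr (subst (r ℕ.∣_) (ℤ.abs-* a b) (ℤ.∣⇒∣ᵤ r∣ab))
... | inj₁ r∣a = inj₁ (ℤ.∣ᵤ⇒∣ r∣a)
... | inj₂ r∣b = inj₂ (ℤ.∣ᵤ⇒∣ r∣b)

module _ {r : ℕ} (prime-r : Prime r) where

  private
    -- `_*_` recurses on its left factor; this is the expansion along the right one, which
    -- `∣ᶜ-*-unit` follows.
    *-cons : ∀ a h b q → (a ∷ h) * (b ∷ q) ≈ map (b ℤ.*_) (a ∷ h) + (0ℤ ∷ (a ∷ h) * q)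
    *-cons a h b q = eval-injective λ x →
      trans (eval-* (a ∷ h) (b ∷ q) x)
        (trans (identity (eval (a ∷ h) x) b x (eval q x))
          (sym (trans (eval-+ (map (b ℤ.*_) (a ∷ h)) (0ℤ ∷ (a ∷ h) * q) x)
            (cong₂ ℤ._+_ (eval-map b (a ∷ h) x)
              (trans (ℤ.+-identityˡ _) (cong (x ℤ.*_) (eval-* (a ∷ h) q x)))))))
      where
      identity : ∀ u b x v → u ℤ.* (b ℤ.+ x ℤ.* v) ≡ b ℤ.* u ℤ.+ x ℤ.* (u ℤ.* v)
      identity = solve-∀

    ∣ᶜ-shift : ∀ {b} p q {s} → + r ℤ.∣ b → s ≈ map (b ℤ.*_) p + (0ℤ ∷ q) → + r ∣ᶜ s → + r ∣ᶜ q
    ∣ᶜ-shift {b} p q r∣b eq r∣s i = ℤ.∣m+n∣m⇒∣n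
      (subst (+ r ℤ.∣_) (trans (eq (suc i)) (coeff-+ (map (b ℤ.*_) p) (0ℤ ∷ q) (suc i))) (r∣s (suc i)))
      (subst (+ r ℤ.∣_) (sym (coeff-map b p (suc i))) (ℤ.∣m⇒∣m*n (coeff p (suc i)) r∣b))

  -- Modulo r the constant term a is a unit. The product starts with a b, so r divides b; removing
  -- `map (b ℤ.*_) (a ∷ h)` leaves the same situation for the rest of the right factor.
  ∣ᶜ-*-unit : ∀ a h q → ¬ + r ℤ.∣ a → + r ∣ᶜ (a ∷ h) * q → + r ∣ᶜ q
  ∣ᶜ-*-unit a h []      r∤a _    i = ℤ.divides 0ℤ refl
  ∣ᶜ-*-unit a h (b ∷ q) r∤a r∣hq
    with prime-∣-* prime-r a b (subst (+ r ℤ.∣_) (ℤ.+-identityʳ (a ℤ.* b)) (r∣hq 0))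
  ... | inj₁ r∣a = ⊥-elim (r∤a r∣a)
  ... | inj₂ r∣b = λ where
    zero    → r∣b
    (suc i) → ∣ᶜ-*-unit a h q r∤a
      (∣ᶜ-shift (a ∷ h) ((a ∷ h) * q) {(a ∷ h) * (b ∷ q)} r∣b (*-cons a h b q) r∣hq) i

  -- Constant terms of h divisible by r are discarded, with the multiples of q that they contribute,
  -- until one is prime to r; from there `∣ᶜ-*-unit` applies.
  gauss : ∀ h q → + r ∣ᶜ h * q → + r ∣ᶜ h ⊎ + r ∣ᶜ q
  gauss []      q _    = inj₁ λ _ → ℤ.divides 0ℤ refl
  gauss (a ∷ h) q r∣hq with + r ℤ.∣? a
  ... | no  r∤a = inj₂ (∣ᶜ-*-unit a h q r∤a r∣hq)
  ... | yes r∣a with gauss h q (∣ᶜ-shift q (h * q) {(a ∷ h) * q} r∣a (λ _ → refl) r∣hq)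
  ...   | inj₁ r∣h = inj₁ λ { zero → r∣a ; (suc i) → r∣h i }
  ...   | inj₂ r∣q = inj₂ r∣q

-- A pseudo-gcd `h` need only divide multiples of P and Q. Here a constant `c` has been split off
-- from it, and `g` divides P and Q themselves over the integers, as `Coprime` requires.
record CommonFactor (P Q h : ℤ[x]) : Set where
  field
    g p q : ℤ[x]
    c     : ℤ
    c≢0   : ¬ c ≡ 0ℤ
    h≡cg  : ∀ x → eval h x ≡ c ℤ.* eval g x
    g∣P   : ∀ x → eval P x ≡ eval p x ℤ.* eval g x
    g∣Q   : ∀ x → eval Q x ≡ eval q x ℤ.* eval g x

+-prime≢0 : ∀ {r} → Prime r → ¬ + r ≡ 0ℤ
+-prime≢0 pr eq = ℕ.≢-nonZero⁻¹ _ {{prime⇒nonZero pr}} (ℤ.+-injective eq)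

cancel-prime : ∀ {r u v} → Prime r → + r ℤ.* u ≡ + r ℤ.* v → u ≡ v
cancel-prime {r} pr = ℤ.*-cancelˡ-≡ (+ r) _ _ {{ℤ.≢-nonZero (+-prime≢0 pr)}}

-- By Gauss's lemma every prime factor of the denominator can be cancelled either from h or from
-- both of the cofactors p and q.
strip-primes : ∀ {rs} → All Prime rs → ∀ P Q h p q →
  (∀ x → + productℕ rs ℤ.* eval P x ≡ eval p x ℤ.* eval h x) →
  (∀ x → + productℕ rs ℤ.* eval Q x ≡ eval q x ℤ.* eval h x) → CommonFactor P Q h
strip-primes [] P Q h p q eqP eqQ = record
  { g = h ; p = p ; q = q ; c = 1ℤ ; c≢0 = λ () ; h≡cg = λ x → sym (ℤ.*-identityˡ (eval h x))
  ; g∣P = λ x → trans (sym (ℤ.*-identityˡ (eval P x))) (eqP x)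
  ; g∣Q = λ x → trans (sym (ℤ.*-identityˡ (eval Q x))) (eqQ x) }
strip-primes {r ∷ rs} (pr ∷ prs) P Q h p q eqP eqQ = case
  where
  k = + productℕ rs

  split : ∀ u → + productℕ (r ∷ rs) ℤ.* u ≡ + r ℤ.* (k ℤ.* u)
  split u = trans (cong (ℤ._* u) (ℤ.pos-* r (productℕ rs))) (ℤ.*-assoc (+ r) k u)

  factor : ∀ F f → (∀ x → + productℕ (r ∷ rs) ℤ.* eval F x ≡ eval f x ℤ.* eval h x) →
    + r ∣ᶜ h ⊎ + r ∣ᶜ f
  factor F f eq = gauss pr h f (∣ᶜ-multiple (h * f) (map (k ℤ.*_) F) λ x →
    trans (eval-* h f x) (trans (ℤ.*-comm (eval h x) (eval f x))
      (trans (sym (eq x)) (trans (split (eval F x)) (cong (+ r ℤ.*_) (sym (eval-map k F x)))))))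

  cancelʳ : ∀ u f {h h′} → + productℕ (r ∷ rs) ℤ.* u ≡ f ℤ.* h → h ≡ + r ℤ.* h′ → k ℤ.* u ≡ f ℤ.* h′
  cancelʳ u f {_} {h′} eq refl = cancel-prime pr
    (trans (sym (split u)) (trans eq (identity (+ r) f h′)))
    where
    identity : ∀ r f h → f ℤ.* (r ℤ.* h) ≡ r ℤ.* (f ℤ.* h)
    identity = solve-∀

  cancelˡ : ∀ u h {f f′} → + productℕ (r ∷ rs) ℤ.* u ≡ f ℤ.* h → f ≡ + r ℤ.* f′ → k ℤ.* u ≡ f′ ℤ.* h
  cancelˡ u h {_} {f′} eq refl = cancel-prime pr
    (trans (sym (split u)) (trans eq (ℤ.*-assoc (+ r) f′ h)))

  fromH : + r ∣ᶜ h → CommonFactor P Q h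
  fromH r∣h with ∣ᶜ-quotient h r∣h
  ... | h′ , h≡rh′ = record
    { g = g ; p = p₁ ; q = q₁ ; c = + r ℤ.* c
    ; c≢0 = λ eq → [ +-prime≢0 pr , c≢0 ]′ (ℤ.i*j≡0⇒i≡0∨j≡0 (+ r) eq)
    ; h≡cg = λ x → trans (h≡rh′ x)
        (trans (cong (+ r ℤ.*_) (h≡cg x)) (sym (ℤ.*-assoc (+ r) c (eval g x))))
    ; g∣P = g∣P ; g∣Q = g∣Q }
    where
    open CommonFactor (strip-primes prs P Q h′ p q
      (λ x → cancelʳ (eval P x) (eval p x) (eqP x) (h≡rh′ x)) (λ x → cancelʳ (eval Q x) (eval q x) (eqQ x) (h≡rh′ x)))
      renaming (p to p₁; q to q₁)

  case : CommonFactor P Q h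
  case with factor P p eqP | factor Q q eqQ
  ... | inj₁ r∣h | _        = fromH r∣h
  ... | inj₂ _   | inj₁ r∣h = fromH r∣h
  ... | inj₂ r∣p | inj₂ r∣q with ∣ᶜ-quotient p r∣p | ∣ᶜ-quotient q r∣q
  ...   | p′ , p≡rp′ | q′ , q≡rq′ = strip-primes prs P Q h p′ q′
          (λ x → cancelˡ (eval P x) (eval h x) (eqP x) (p≡rp′ x)) (λ x → cancelˡ (eval Q x) (eval h x) (eqQ x) (q≡rq′ x))

clear-denominator : ∀ {P Q h} k p q → ¬ k ≡ 0ℤ →
  (∀ x → k ℤ.* eval P x ≡ eval p x ℤ.* eval h x) →
  (∀ x → k ℤ.* eval Q x ≡ eval q x ℤ.* eval h x) → CommonFactor P Q h
clear-denominator (+ zero) p q k≢0 eqP eqQ = ⊥-elim (k≢0 refl)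
clear-denominator {P} {Q} {h} (+ suc n) p q k≢0 eqP eqQ =
  strip-primes factorsPrime P Q h p q
    (λ x → trans (cong (λ k → + k ℤ.* eval P x) (sym isFactorisation)) (eqP x))
    (λ x → trans (cong (λ k → + k ℤ.* eval Q x) (sym isFactorisation)) (eqQ x))
  where open PrimeFactorisation (factorise (suc n))
clear-denominator {P} {Q} {h} (-[1+ n ]) p q k≢0 eqP eqQ =
  clear-denominator (+ suc n) (- p) (- q) (λ ()) (flip P p eqP) (flip Q q eqQ)
  where
  flip : ∀ F f → (∀ x → -[1+ n ] ℤ.* eval F x ≡ eval f x ℤ.* eval h x) →
    ∀ x → + suc n ℤ.* eval F x ≡ eval (- f) x ℤ.* eval h x
  flip F f eq x = trans (sym (ℤ.neg-distribˡ-* -[1+ n ] (eval F x)))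
    (trans (cong ℤ.-_ (eq x)) (trans (ℤ.neg-distribˡ-* (eval f x) (eval h x))
      (cong (ℤ._* eval h x) (sym (eval-neg f x)))))

-- The polynomial `g` extracted from the pseudo-gcd h is a common divisor of P and Q over the
-- integers, so it divides 1 and is a constant b. Then h = c g is the nonzero constant c b, and its
-- Bézout identity is the required one.
coprime⇒bézout : ∀ P Q → Coprime P Q → ∃[ U ] ∃[ V ] ∃[ R ]
  (¬ R ≡ 0ℤ × (∀ x → eval U x ℤ.* eval P x ℤ.+ eval V x ℤ.* eval Q x ≡ R))
coprime⇒bézout P Q coprime = G.U , G.V , c ℤ.* b , cb≢0 , λ x →
    trans (sym (G.bézout x)) (trans (h≡cg x) (cong (c ℤ.*_) (g-const x)))
  where
  module G = PseudoGcd (pseudoGcd P Q)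
  open CommonFactor (clear-denominator {P} {Q} {G.h} G.k G.p G.q G.k≢0 G.h∣kP G.h∣kQ)

  divides : ∀ F f → (∀ x → eval F x ≡ eval f x ℤ.* eval g x) → f * g ≈ F
  divides F f eq = eval-injective {f * g} {F} λ x → trans (eval-* f g x) (sym (eq x))

  g∣1 : ∃[ u ] (u * g ≈ [ 1ℤ ])
  g∣1 with coprime {g} (record { quotient = p ; equality = divides P p g∣P })
                       (record { quotient = q ; equality = divides Q q g∣Q })
  ... | record { quotient = u ; equality = eq } = u , eq

  g-unit : ∃[ b ] (¬ b ≡ 0ℤ × (∀ x → eval g x ≡ b))
  g-unit with g∣1
  ... | u , ug≈1 = analyse (zero⊎top u) (zero⊎top g)
    where
    ug≡1 : ∀ x → eval u x ℤ.* eval g x ≡ 1ℤ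
    ug≡1 x = trans (sym (eval-* u g x)) (trans (eval-cong {u * g} ug≈1 x) (eval-const 1ℤ x))

    analyse : Below u 0 ⊎ ∃[ d ] ∃[ a ] (¬ a ≡ 0ℤ × Top u d a) →
      Below g 0 ⊎ ∃[ e ] ∃[ b ] (¬ b ≡ 0ℤ × Top g e b) → ∃[ b ] (¬ b ≡ 0ℤ × (∀ x → eval g x ≡ b))
    analyse (inj₁ z) _ with trans (sym (ug≡1 0ℤ)) (cong (ℤ._* eval g 0ℤ) (eval-below0 {u} z 0ℤ))
    ... | ()
    analyse (inj₂ _) (inj₁ z) with trans (sym (ug≡1 0ℤ)) (trans (cong (eval u 0ℤ ℤ.*_) (eval-below0 {g} z 0ℤ)) (ℤ.*-zeroʳ (eval u 0ℤ)))
    ... | ()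
    analyse (inj₂ (d , a , a≢0 , t)) (inj₂ (e , b , b≢0 , t′))
      with ℕ.m+n≡0⇒n≡0 d (top-unique (λ eq → [ a≢0 , b≢0 ]′ (ℤ.i*j≡0⇒i≡0∨j≡0 a eq)) (λ ())
             (top (trans (sym (ug≈1 _)) (coeff≡ (top-* t t′))) λ le → trans (sym (ug≈1 _)) (above (top-* t t′) le))
             (top-const 1ℤ))
    ... | refl = b , b≢0 , eval-top0 t′

  b = proj₁ g-unit
  g-const = proj₂ (proj₂ g-unit)

  cb≢0 : ¬ c ℤ.* b ≡ 0ℤ
  cb≢0 eq = [ c≢0 , proj₁ (proj₂ g-unit) ]′ (ℤ.i*j≡0⇒i≡0∨j≡0 c eq)

-- Prime divisors and the ABC-Conjecture

∣-^ : ∀ {a b} n → a ℤ.∣ b → a ℤ.^ n ℤ.∣ b ℤ.^ n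
∣-^ zero    a∣b = ℤ.∣-refl
∣-^ {a} {b} (suc n) a∣b = ℤ.∣-trans (ℤ.*-monoʳ-∣ a (∣-^ n a∣b)) (ℤ.*-monoˡ-∣ (b ℤ.^ n) a∣b)

-- The sum of the exponents serves as N: with u the first factor, v the product of the others and w
-- their power product, u^a divides (u v)^a and w divides v^N, which divides (u v)^N.
powerProduct-∣ : ∀ {k} (f : Vector ℤ[x] k) (α : Vector ℕ k) →
  ∃[ N ] (∀ x → eval (powerProduct f α) x ℤ.∣ eval (product f) x ℤ.^ N)
powerProduct-∣ {zero}  f α = 0 , λ x → ℤ.∣-reflexive (eval-const 1ℤ x)
powerProduct-∣ {suc k} f α with powerProduct-∣ (tail f) (tail α)
... | N , divides = α Fin.zero ℕ.+ N , λ x →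
  let u  = eval (f Fin.zero) x
      v  = eval (product (tail f)) x
      w  = eval (powerProduct (tail f) (tail α)) x
      a  = α Fin.zero
      uv = eval (product f) x
      uv≡ : uv ≡ u ℤ.* v
      uv≡ = eval-* (f Fin.zero) (product (tail f)) x
  in subst₂ ℤ._∣_
    (sym (trans (eval-* (f Fin.zero ^ a) (powerProduct (tail f) (tail α)) x)
           (cong (ℤ._* w) (eval-^ (f Fin.zero) a x))))
    (sym (trans (cong (ℤ._^ (a ℕ.+ N)) uv≡) (ℤ.^-distribˡ-+-* (u ℤ.* v) a N)))
    (ℤ.∣-trans (ℤ.*-monoˡ-∣ w (∣-^ a (ℤ.∣m⇒∣m*n v (ℤ.∣-refl {u}))))
      (ℤ.*-monoʳ-∣ ((u ℤ.* v) ℤ.^ a) (ℤ.∣-trans (divides x) (∣-^ N (ℤ.∣n⇒∣m*n u (ℤ.∣-refl {v}))))))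

-- Behind it is that R in the ideal (p, q) implies R^(a + b) in (p^a, q^b). One factor R is expanded
-- as u p + v q; the p or q so gained moves into t and makes up for the exponent that was lowered,
-- which is why t is carried along.
comaximal-^ : ∀ {d p q u v R} → u ℤ.* p ℤ.+ v ℤ.* q ≡ R → ∀ a b t →
  d ℤ.∣ p ℤ.^ a ℤ.* t → d ℤ.∣ q ℤ.^ b ℤ.* t → d ℤ.∣ R ℤ.^ (a ℕ.+ b) ℤ.* t
comaximal-^ {R = R} eq zero    b       t d∣p d∣q =
  ℤ.∣n⇒∣m*n (R ℤ.^ b) (subst (_ ℤ.∣_) (ℤ.*-identityˡ t) d∣p)
comaximal-^ {R = R} eq (suc a) zero    t d∣p d∣q =
  ℤ.∣n⇒∣m*n (R ℤ.^ (suc a ℕ.+ 0)) (subst (_ ℤ.∣_) (ℤ.*-identityˡ t) d∣q)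
comaximal-^ {d} {p} {q} {u} {v} {R} refl (suc a) (suc b) t d∣p d∣q =
  subst (d ℤ.∣_) (identity p q u v (R ℤ.^ (a ℕ.+ suc b)) t)
    (ℤ.∣m∣n⇒∣m+n (ℤ.∣n⇒∣m*n u viaP) (ℤ.∣n⇒∣m*n v viaQ))
  where
  swap : ∀ p s t → (p ℤ.* s) ℤ.* t ≡ s ℤ.* (p ℤ.* t)
  swap = solve-∀
  swap′ : ∀ p s t → p ℤ.* (s ℤ.* t) ≡ s ℤ.* (p ℤ.* t)
  swap′ = solve-∀

  viaP : d ℤ.∣ R ℤ.^ (a ℕ.+ suc b) ℤ.* (p ℤ.* t)
  viaP = comaximal-^ {u = u} {v} refl a (suc b) (p ℤ.* t) (subst (d ℤ.∣_) (swap p (p ℤ.^ a) t) d∣p)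
    (subst (d ℤ.∣_) (swap′ p (q ℤ.^ suc b) t) (ℤ.∣n⇒∣m*n p d∣q))

  viaQ : d ℤ.∣ R ℤ.^ (a ℕ.+ suc b) ℤ.* (q ℤ.* t)
  viaQ = subst (λ n → d ℤ.∣ R ℤ.^ n ℤ.* (q ℤ.* t)) (sym (ℕ.+-suc a b))
    (comaximal-^ {u = u} {v} refl (suc a) b (q ℤ.* t)
      (subst (d ℤ.∣_) (swap′ q (p ℤ.^ suc a) t) (ℤ.∣n⇒∣m*n q d∣p))
      (subst (d ℤ.∣_) (swap q (q ℤ.^ b) t) d∣q))

  identity : ∀ p q u v s t →
    u ℤ.* (s ℤ.* (p ℤ.* t)) ℤ.+ v ℤ.* (s ℤ.* (q ℤ.* t)) ≡ (u ℤ.* p ℤ.+ v ℤ.* q) ℤ.* s ℤ.* t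
  identity = solve-∀

abs-^ : ∀ i n → ∣ i ℤ.^ n ∣ ≡ ∣ i ∣ ℕ.^ n
abs-^ i zero    = refl
abs-^ i (suc n) = trans (ℤ.abs-* i (i ℤ.^ n)) (cong (∣ i ∣ ℕ.*_) (abs-^ i n))

prime-∣-^ : ∀ {r} → Prime r → ∀ m n → r ℕ.∣ m ℕ.^ n → r ℕ.∣ m
prime-∣-^ pr m zero    r∣1 = ℕ.∣-trans r∣1 (ℕ.1∣ m)
prime-∣-^ pr m (suc n) r∣  = [ (λ r∣m → r∣m) , prime-∣-^ pr m n ]′ (euclidsLemma m (m ℕ.^ n) pr r∣)

-- Being prime and different from all the primes in `ps`, p does not divide their product, so it
-- divides the cofactor k.
product-primes-∣ : ∀ {m ps} → Unique ps → All (λ p → Prime p × p ℕ.∣ m) ps → productℕ ps ℕ.∣ m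
product-primes-∣ {m} [] [] = ℕ.1∣ m
product-primes-∣ {m} {p ∷ ps} (p≢ ∷ unique) ((pr , p∣m) ∷ all) with product-primes-∣ unique all
... | ℕ.divides k refl with euclidsLemma k (productℕ ps) pr p∣m
...   | inj₁ p∣k = ℕ.*-monoˡ-∣ (productℕ ps) p∣k
...   | inj₂ p∣Π = ⊥-elim (All.lookup p≢ (factorisationHasAllPrimeFactors pr p∣Π (All.map proj₁ all)) refl)

rad≤ : ∀ n m → 1 ℕ.≤ m → (∀ {r} → Prime r → r ℕ.∣ n → r ℕ.∣ m) → rad n ℕ.≤ m
rad≤ n m 1≤m imp = ℕ.∣⇒≤ {{ℕ.>-nonZero 1≤m}} (product-primes-∣
  (filter⁺ P? (upTo⁺ (suc n)))
  (All.map (λ (pr , r∣n) → pr , imp pr r∣n) (all-filter P? (upTo (suc n)))))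
  where P? = λ p → prime? p ×-dec (p ℕ.∣? n)

-- This brings an equation between signed integers into the shape a + b = c of the ABC-Conjecture;
-- which absolute value becomes c depends on signs and sizes.
∣i+j∣-cases : ∀ i j → let k = i ℤ.+ j in
  ∣ i ∣ ℕ.+ ∣ j ∣ ≡ ∣ k ∣ ⊎ ∣ j ∣ ℕ.+ ∣ k ∣ ≡ ∣ i ∣ ⊎ ∣ i ∣ ℕ.+ ∣ k ∣ ≡ ∣ j ∣
∣i+j∣-cases (+ m)      (+ n)      = inj₁ refl
∣i+j∣-cases (-[1+ m ]) (-[1+ n ]) = inj₁ (ℕ.+-suc (suc m) n)
∣i+j∣-cases (+ m)      (-[1+ n ]) with ℕ.≤-total m (suc n)
... | inj₁ le = inj₂ (inj₂ (trans (cong (m ℕ.+_) (ℤ.∣⊖∣-≤ le)) (ℕ.m+[n∸m]≡n le)))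
... | inj₂ le = inj₂ (inj₁ (trans (cong (suc n ℕ.+_) (trans (ℤ.∣m⊖n∣≡∣n⊖m∣ m (suc n)) (ℤ.∣⊖∣-≤ le))) (ℕ.m+[n∸m]≡n le)))
∣i+j∣-cases (-[1+ n ]) (+ m)      with ℕ.≤-total m (suc n)
... | inj₁ le = inj₂ (inj₁ (trans (cong (m ℕ.+_) (ℤ.∣⊖∣-≤ le)) (ℕ.m+[n∸m]≡n le)))
... | inj₂ le = inj₂ (inj₂ (trans (cong (suc n ℕ.+_) (trans (ℤ.∣m⊖n∣≡∣n⊖m∣ m (suc n)) (ℤ.∣⊖∣-≤ le))) (ℕ.m+[n∸m]≡n le)))

∣m*n⊎ : ∀ {r N} → Prime r → ∀ a b c → (r ℕ.∣ a → r ℕ.∣ N) → (r ℕ.∣ b → r ℕ.∣ N) → (r ℕ.∣ c → r ℕ.∣ N) →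
  r ℕ.∣ a ℕ.* b ℕ.* c → r ℕ.∣ N
∣m*n⊎ pr a b c fa fb fc r∣ with euclidsLemma (a ℕ.* b) c pr r∣
... | inj₂ r∣c  = fc r∣c
... | inj₁ r∣ab = [ fa , fb ]′ (euclidsLemma a b pr r∣ab)

PrimesDivide : ℕ → ℕ → Set
PrimesDivide a N = ∀ {r} → Prime r → r ℕ.∣ a → r ℕ.∣ N

^-distribʳ-* : ∀ a b n → (a ℕ.* b) ℕ.^ n ≡ a ℕ.^ n ℕ.* b ℕ.^ n
^-distribʳ-* a b zero    = refl
^-distribʳ-* a b (suc n) = trans (cong (a ℕ.* b ℕ.*_) (^-distribʳ-* a b n))
  (interchange a b (a ℕ.^ n) (b ℕ.^ n))
  where
  interchange : ∀ a b u v → a ℕ.* b ℕ.* (u ℕ.* v) ≡ a ℕ.* u ℕ.* (b ℕ.* v)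
  interchange = ℕ.solve-∀

module _ (abc : ABC-Conjecture) (s : ℕ) where

  private
    ε : ℚ
    -- `mkℚ` stores the denominator minus one, so ε = 1 / (s + 1), and the exponents in the
    -- conjecture become s + 1 and s + 2.
    ε = mkℚ (+ 1) s (1-coprimeTo (suc s))

    0<ε : 0ℚ ℚ.< ε
    0<ε = ℚ.*<* (ℤ.+<+ (s≤s z≤n))

    C : ℕ
    C = proj₁ (abc ε 0<ε)

    Bound : ℕ → ℕ → Set
    Bound c N = c ℕ.^ suc s ℕ.≤ C ℕ.^ suc s ℕ.* N ℕ.^ (suc s ℕ.+ 1)

    abc-ℕ : ∀ a b c N → 1 ℕ.≤ a → 1 ℕ.≤ b → 1 ℕ.≤ c → 1 ℕ.≤ N →
      (∀ d → d ℕ.∣ a → d ℕ.∣ b → d ℕ.∣ c → d ≡ 1) → a ℕ.+ b ≡ c →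
      PrimesDivide a N → PrimesDivide b N → PrimesDivide c N → Bound c N
    abc-ℕ a b c N 1≤a 1≤b 1≤c 1≤N coprime a+b≡c pa pb pc = ℕ.≤-trans
      (proj₂ (abc ε 0<ε) a b c 1≤a 1≤b 1≤c
        (coprime _ (ℕ.∣-trans (gcd[m,n]∣m (gcd a b) c) (gcd[m,n]∣m a b))
                   (ℕ.∣-trans (gcd[m,n]∣m (gcd a b) c) (gcd[m,n]∣n a b))
                   (gcd[m,n]∣n (gcd a b) c)) a+b≡c)
      (ℕ.*-monoʳ-≤ (C ℕ.^ suc s) (ℕ.^-monoˡ-≤ (suc s ℕ.+ 1)
        (rad≤ (a ℕ.* b ℕ.* c) N 1≤N (λ pr → ∣m*n⊎ pr a b c (pa pr) (pb pr) (pc pr)))))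

    bound-≤ : ∀ {a c N} → a ℕ.≤ c → Bound c N → Bound a N
    bound-≤ a≤c = ℕ.≤-trans (ℕ.^-monoˡ-≤ (suc s) a≤c)

    -- Whichever of the three absolute values takes the place of c, it is the largest one, so a
    -- bound for it also holds for |z|.
    abc-ℤ : ∀ x y N → let z = x ℤ.+ y in
      1 ℕ.≤ ∣ x ∣ → 1 ℕ.≤ ∣ y ∣ → 1 ℕ.≤ ∣ z ∣ → 1 ℕ.≤ N →
      (∀ d → d ℕ.∣ ∣ x ∣ → d ℕ.∣ ∣ y ∣ → d ≡ 1) →
      PrimesDivide ∣ x ∣ N → PrimesDivide ∣ y ∣ N → PrimesDivide ∣ z ∣ N → Bound ∣ z ∣ N
    abc-ℤ x y N 1≤x 1≤y 1≤z 1≤N coprime px py pz with ∣i+j∣-cases x y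
    ... | inj₁ eq = abc-ℕ (∣ x ∣) (∣ y ∣) _ N 1≤x 1≤y 1≤z 1≤N (λ d dx dy _ → coprime d dx dy) eq px py pz
    ... | inj₂ (inj₁ eq) = bound-≤ {N = N} (subst (∣ x ℤ.+ y ∣ ℕ.≤_) eq (ℕ.m≤n+m _ ∣ y ∣))
            (abc-ℕ (∣ y ∣) _ (∣ x ∣) N 1≤y 1≤z 1≤x 1≤N (λ d dy _ dx → coprime d dx dy) eq py pz px)
    ... | inj₂ (inj₂ eq) = bound-≤ {N = N} (subst (∣ x ℤ.+ y ∣ ℕ.≤_) eq (ℕ.m≤n+m _ ∣ x ∣))
            (abc-ℕ (∣ x ∣) _ (∣ y ∣) N 1≤x 1≤z 1≤y 1≤N (λ d dx _ dy → coprime d dx dy) eq px pz py)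

  -- Division by g = gcd(X, Y) makes the terms coprime, and the primes of the quotients still divide
  -- N. Multiplying back costs g^(s + 1), at most D^(s + 1). `C` is fixed before D and the integers.
  abc-bounded-gcd : ∃[ C ] (∀ X Y N D → let Z = X ℤ.+ Y in
    ¬ X ≡ 0ℤ → ¬ Y ≡ 0ℤ → ¬ Z ≡ 0ℤ → 1 ℕ.≤ N →
    (∀ d → + d ℤ.∣ X → + d ℤ.∣ Y → d ℕ.≤ D) →
    PrimesDivide ∣ X ∣ N → PrimesDivide ∣ Y ∣ N → PrimesDivide ∣ Z ∣ N →
    ∣ Z ∣ ℕ.^ suc s ℕ.≤ (D ℕ.* C) ℕ.^ suc s ℕ.* N ℕ.^ (suc s ℕ.+ 1))
  abc-bounded-gcd = C , bound
    where
    bound : ∀ X Y N D → let Z = X ℤ.+ Y in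
      ¬ X ≡ 0ℤ → ¬ Y ≡ 0ℤ → ¬ Z ≡ 0ℤ → 1 ℕ.≤ N →
      (∀ d → + d ℤ.∣ X → + d ℤ.∣ Y → d ℕ.≤ D) →
      PrimesDivide ∣ X ∣ N → PrimesDivide ∣ Y ∣ N → PrimesDivide ∣ Z ∣ N →
      ∣ Z ∣ ℕ.^ suc s ℕ.≤ (D ℕ.* C) ℕ.^ suc s ℕ.* N ℕ.^ (suc s ℕ.+ 1)
    bound X Y N D X≢0 Y≢0 Z≢0 1≤N gcd≤D pX pY pZ
      with ℤ.∣ᵤ⇒∣ {+ gcd ∣ X ∣ ∣ Y ∣} {X} (gcd[m,n]∣m ∣ X ∣ ∣ Y ∣)
         | ℤ.∣ᵤ⇒∣ {+ gcd ∣ X ∣ ∣ Y ∣} {Y} (gcd[m,n]∣n ∣ X ∣ ∣ Y ∣)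
    ... | ℤ.divides x X≡xg | ℤ.divides y Y≡yg = begin
        ∣ X ℤ.+ Y ∣ ℕ.^ suc s
          ≡⟨ cong (ℕ._^ suc s) (∣∣≡ z Z≡zg) ⟩
        (∣ z ∣ ℕ.* g) ℕ.^ suc s
          ≡⟨ ^-distribʳ-* ∣ z ∣ g (suc s) ⟩
        ∣ z ∣ ℕ.^ suc s ℕ.* g ℕ.^ suc s
          ≤⟨ ℕ.*-mono-≤
               (abc-ℤ x y N (nonZero x X≡xg X≢0) (nonZero y Y≡yg Y≢0) (nonZero z Z≡zg Z≢0) 1≤N coprime
                 (primes x X≡xg pX) (primes y Y≡yg pY) (primes z Z≡zg pZ))
               (ℕ.^-monoˡ-≤ (suc s) (gcd≤D g (ℤ.divides x X≡xg) (ℤ.divides y Y≡yg))) ⟩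
        C ℕ.^ suc s ℕ.* N ℕ.^ (suc s ℕ.+ 1) ℕ.* D ℕ.^ suc s
          ≡⟨ identity (C ℕ.^ suc s) (N ℕ.^ (suc s ℕ.+ 1)) (D ℕ.^ suc s) ⟩
        D ℕ.^ suc s ℕ.* C ℕ.^ suc s ℕ.* N ℕ.^ (suc s ℕ.+ 1)
          ≡⟨ cong (ℕ._* N ℕ.^ (suc s ℕ.+ 1)) (^-distribʳ-* D C (suc s)) ⟨
        (D ℕ.* C) ℕ.^ suc s ℕ.* N ℕ.^ (suc s ℕ.+ 1) ∎
      where
      open ℕ.≤-Reasoning
      g = gcd ∣ X ∣ ∣ Y ∣
      z = x ℤ.+ y

      identity : ∀ c n d → c ℕ.* n ℕ.* d ≡ d ℕ.* c ℕ.* n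
      identity = ℕ.solve-∀

      Z≡zg : X ℤ.+ Y ≡ z ℤ.* + g
      Z≡zg = trans (cong₂ ℤ._+_ X≡xg Y≡yg) (sym (ℤ.*-distribʳ-+ (+ g) x y))

      ∣∣≡ : ∀ {W} w → W ≡ w ℤ.* + g → ∣ W ∣ ≡ ∣ w ∣ ℕ.* g
      ∣∣≡ w eq = trans (cong ∣_∣ eq) (ℤ.abs-* w (+ g))

      nonZero : ∀ {W} w → W ≡ w ℤ.* + g → ¬ W ≡ 0ℤ → 1 ℕ.≤ ∣ w ∣
      nonZero w eq W≢0 = 1≤∣_∣ {w} (λ { refl → W≢0 eq })

      primes : ∀ {W} w → W ≡ w ℤ.* + g → PrimesDivide ∣ W ∣ N → PrimesDivide ∣ w ∣ N
      primes w eq pW pr r∣w = pW pr (subst (_ ℕ.∣_) (sym (∣∣≡ w eq)) (ℕ.∣m⇒∣m*n g r∣w))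

      g≢0 : ℕ.NonZero g
      g≢0 = ℕ.≢-nonZero λ g≡0 → X≢0 (trans X≡xg (trans (cong (λ k → x ℤ.* + k) g≡0) (ℤ.*-zeroʳ x)))

      coprime : ∀ d → d ℕ.∣ ∣ x ∣ → d ℕ.∣ ∣ y ∣ → d ≡ 1
      coprime d d∣x d∣y = ℕ.∣1⇒≡1 (ℕ.*-cancelʳ-∣ g {{g≢0}} (subst (d ℕ.* g ℕ.∣_) (sym (ℕ.*-identityˡ g))
        (gcd-greatest (subst (d ℕ.* g ℕ.∣_) (sym (∣∣≡ x X≡xg)) (ℕ.*-monoˡ-∣ g d∣x))
                      (subst (d ℕ.* g ℕ.∣_) (sym (∣∣≡ y Y≡yg)) (ℕ.*-monoˡ-∣ g d∣y)))))

interval : ℕ → List ℤ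
interval N = map +_ (upTo (suc N)) ++ map -[1+_] (upTo N)

∈-interval : ∀ {N} x → ∣ x ∣ ℕ.≤ N → x ∈ interval N
∈-interval (+ n)      n≤N = ∈-++⁺ˡ (∈-map⁺ +_ (∈-upTo⁺ (s≤s n≤N)))
∈-interval {N} (-[1+ n ]) n<N = ∈-++⁺ʳ (map +_ (upTo (suc N))) (∈-map⁺ -[1+_] (∈-upTo⁺ n<N))

-- Finiteness

-- What the argument uses of a product of powers: it controls prime divisors, vanishing and the gcd.
-- The exponent does not depend on x, so the bound for the gcd is uniform.
_∣PowerOf_ : ℤ[x] → ℤ[x] → Set
p ∣PowerOf q = ∃[ n ] (∀ x → eval p x ℤ.∣ eval q x ℤ.^ n)

∣PowerOf-primes : ∀ {p q} → p ∣PowerOf q → ∀ x → PrimesDivide ∣ eval p x ∣ ∣ eval q x ∣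
∣PowerOf-primes {p} {q} (n , p∣q^n) x pr r∣p = prime-∣-^ pr ∣ eval q x ∣ n
  (subst (_ ℕ.∣_) (abs-^ (eval q x) n) (ℕ.∣-trans r∣p (ℤ.∣⇒∣ᵤ (p∣q^n x))))

∣PowerOf-≢0 : ∀ {p q} → p ∣PowerOf q → ∀ x → ¬ eval q x ≡ 0ℤ → ¬ eval p x ≡ 0ℤ
∣PowerOf-≢0 {p} {q} (n , p∣q^n) x qx≢0 px≡0 =
  qx≢0 (ℤ.∣i∣≡0⇒i≡0 (ℕ.m^n≡0⇒m≡0 ∣ eval q x ∣ n
    (trans (sym (abs-^ (eval q x) n)) (cong ∣_∣ (ℤ.0∣⇒≡0 (subst (ℤ._∣ eval q x ℤ.^ n) px≡0 (p∣q^n x)))))))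

-- The exponents of w differ by (e + 1)(e + 2) − e (e + 3) = 2.
cancel-powers : ∀ w e K → 1 ℕ.≤ w →
  (w ℕ.^ suc e) ℕ.^ suc (suc e) ℕ.≤ K ℕ.* (w ℕ.^ e) ℕ.^ (suc (suc e) ℕ.+ 1) → w ℕ.≤ K
cancel-powers w e K 1≤w le = begin
    w         ≡⟨ ℕ.*-identityʳ w ⟨
    w ℕ.* 1   ≤⟨ ℕ.*-monoʳ-≤ w 1≤w ⟩
    w ℕ.* w   ≤⟨ ℕ.*-cancelʳ-≤ (w ℕ.* w) K W {{ℕ.>-nonZero (1≤^ (e ℕ.* (suc (suc e) ℕ.+ 1)) 1≤w)}} w*w*W≤K*W ⟩
    K         ∎
  where
  open ℕ.≤-Reasoning
  W = w ℕ.^ (e ℕ.* (suc (suc e) ℕ.+ 1))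

  exponent : ∀ e → (1 ℕ.+ e) ℕ.* (2 ℕ.+ e) ≡ 2 ℕ.+ e ℕ.* (2 ℕ.+ e ℕ.+ 1)
  exponent = ℕ.solve-∀

  w*w*W≤K*W : w ℕ.* w ℕ.* W ℕ.≤ K ℕ.* W
  w*w*W≤K*W = begin
    w ℕ.* w ℕ.* W                                      ≡⟨ ℕ.*-assoc w w W ⟩
    w ℕ.^ (2 ℕ.+ e ℕ.* (suc (suc e) ℕ.+ 1))            ≡⟨ cong (w ℕ.^_) (exponent e) ⟨
    w ℕ.^ (suc e ℕ.* suc (suc e))                      ≡⟨ ℕ.^-*-assoc w (suc e) (suc (suc e)) ⟨
    (w ℕ.^ suc e) ℕ.^ suc (suc e)                      ≤⟨ le ⟩
    K ℕ.* (w ℕ.^ e) ℕ.^ (suc (suc e) ℕ.+ 1)            ≡⟨ cong (K ℕ.*_) (ℕ.^-*-assoc w e (suc (suc e) ℕ.+ 1)) ⟩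
    K ℕ.* W                                            ∎

≤-sum₄ : ∀ a b c d {n} → n ℕ.≤ a ⊎ n ℕ.≤ b ⊎ n ℕ.≤ c ⊎ n ℕ.≤ d → n ℕ.≤ a ℕ.+ b ℕ.+ c ℕ.+ d
≤-sum₄ a b c d (inj₁ le)               = ℕ.m≤n⇒m≤n+o d (ℕ.m≤n⇒m≤n+o c (ℕ.m≤n⇒m≤n+o b le))
≤-sum₄ a b c d (inj₂ (inj₁ le))        = ℕ.m≤n⇒m≤n+o d (ℕ.m≤n⇒m≤n+o c (ℕ.m≤n⇒m≤o+n a le))
≤-sum₄ a b c d (inj₂ (inj₂ (inj₁ le))) = ℕ.m≤n⇒m≤n+o d (ℕ.m≤n⇒m≤o+n (a ℕ.+ b) le)
≤-sum₄ a b c d (inj₂ (inj₂ (inj₂ le))) = ℕ.m≤n⇒m≤o+n (a ℕ.+ b ℕ.+ c) le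

-- With deg f = F + 1 and deg g = e + 2, the condition deg g < deg f reads e + 2 ≤ F, and 1 + deg (P
-- Q G) < deg g reads deg (P Q G) ≤ e. The sign in the equation is absorbed into `B`.
module Solutions
  {P Q G A B f g : ℤ[x]} {dP dQ dG e F : ℕ} {a b c₁ c₂ c₃ : ℤ}
  (a≢0 : ¬ a ≡ 0ℤ) (top-f : Top f (suc F) a)
  (b≢0 : ¬ b ≡ 0ℤ) (top-g : Top g (suc (suc e)) b)
  (c₁≢0 : ¬ c₁ ≡ 0ℤ) (top-P : Top P dP c₁)
  (c₂≢0 : ¬ c₂ ≡ 0ℤ) (top-Q : Top Q dQ c₂)
  (c₃≢0 : ¬ c₃ ≡ 0ℤ) (top-G : Top G dG c₃)
  (deg-g≤F : suc (suc e) ℕ.≤ F) (deg-PQG≤e : dP ℕ.+ dQ ℕ.+ dG ℕ.≤ e)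
  (A∣P : A ∣PowerOf P) (B∣Q : B ∣PowerOf Q) (g∣G : g ∣PowerOf G)
  (f≡A+B : ∀ x → eval f x ≡ eval A x ℤ.+ eval B x)
  (coprime : Coprime P Q) (abc : ABC-Conjecture)
  where

  open ℕ.≤-Reasoning

  private
    E = suc (suc e)
    nA = proj₁ A∣P
    nB = proj₁ B∣Q

    bézout = coprime⇒bézout P Q coprime
    R   = proj₁ (proj₂ (proj₂ bézout))
    R≢0 = proj₁ (proj₂ (proj₂ (proj₂ bézout)))

    D = ∣ R ∣ ℕ.^ (nA ℕ.+ nB)

    -- A common divisor of A(x) and B(x) divides P(x)^nA and Q(x)^nB, hence R^(nA + nB) by
    -- `comaximal-^` with t = 1, a number independent of x.
    gcd≤D : ∀ x d → + d ℤ.∣ eval A x → + d ℤ.∣ eval B x → d ℕ.≤ D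
    gcd≤D x d d∣A d∣B = ℕ.∣⇒≤ {{ℕ.>-nonZero (1≤^ (nA ℕ.+ nB) 1≤∣ R≢0 ∣)}}
      (subst (d ℕ.∣_) (abs-^ R (nA ℕ.+ nB)) (ℤ.∣⇒∣ᵤ (subst (+ d ℤ.∣_) (ℤ.*-identityʳ (R ℤ.^ (nA ℕ.+ nB)))
        (comaximal-^ {u = eval (proj₁ bézout) x} {eval (proj₁ (proj₂ bézout)) x}
          (proj₂ (proj₂ (proj₂ (proj₂ bézout))) x) nA nB 1ℤ
          (subst (+ d ℤ.∣_) (sym (ℤ.*-identityʳ _)) (ℤ.∣-trans d∣A (proj₂ A∣P x)))
          (subst (+ d ℤ.∣_) (sym (ℤ.*-identityʳ _)) (ℤ.∣-trans d∣B (proj₂ B∣Q x)))))))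

    upper-f = upper-bound f (suc F) (Top.above top-f)
    upper-g = upper-bound g E (Top.above top-g)
    upper-P = upper-bound P dP (Top.above top-P)
    upper-Q = upper-bound Q dQ (Top.above top-Q)
    upper-G = upper-bound G dG (Top.above top-G)
    Hf = proj₁ upper-f
    Hg = proj₁ upper-g
    H  = proj₁ upper-P ℕ.* proj₁ upper-Q ℕ.* proj₁ upper-G

    -- The factor Hg + 1 is chosen to beat the constant Hg in the upper bound for |g|.
    lower-f = lower-bound a≢0 top-f (suc Hg)
    lower-g = lower-bound b≢0 top-g 1
    Y₀ = suc (proj₁ lower-f ℕ.+ proj₁ lower-g)

    C = proj₁ (abc-bounded-gcd abc (suc e))
    K = (D ℕ.* C) ℕ.^ E ℕ.* H ℕ.^ (E ℕ.+ 1)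

  module _ {x y : ℤ} (fx≡gy : eval f x ≡ eval g y) where

    private
      w = ∣ y ∣
      N = ∣ eval P x ∣ ℕ.* ∣ eval Q x ∣ ℕ.* ∣ eval G y ∣

    -- If |y| < |x|, then (Hg + 1) |x|^F ≤ |f(x)| = |g(y)| ≤ Hg |x|^E ≤ Hg |x|^F, which is absurd as
    -- |x| ≥ 1.
    ∣x∣≤∣y∣ : Y₀ ℕ.≤ w → ∣ x ∣ ℕ.≤ w
    ∣x∣≤∣y∣ Y₀≤y = ℕ.≮⇒≥ λ y<x → ℕ.<-irrefl refl (begin
      suc (Hg ℕ.* ∣ x ∣ ℕ.^ F)
        ≤⟨ ℕ.+-monoˡ-≤ (Hg ℕ.* ∣ x ∣ ℕ.^ F) (1≤^ F (1≤x y<x)) ⟩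
      suc Hg ℕ.* ∣ x ∣ ℕ.^ F
        ≤⟨ proj₂ lower-f x (ℕ.≤-trans (ℕ.≤-trans (ℕ.m≤m+n _ _) (ℕ.n≤1+n _)) (ℕ.≤-trans Y₀≤y (ℕ.<⇒≤ y<x))) ⟩
      ∣ eval f x ∣
        ≡⟨ cong ∣_∣ fx≡gy ⟩
      ∣ eval g y ∣
        ≤⟨ proj₂ upper-g y ∣ x ∣ (ℕ.<⇒≤ y<x) (1≤x y<x) ⟩
      Hg ℕ.* ∣ x ∣ ℕ.^ E
        ≤⟨ ℕ.*-monoʳ-≤ Hg (ℕ.^-monoʳ-≤ ∣ x ∣ {{ℕ.>-nonZero (1≤x y<x)}} deg-g≤F) ⟩
      Hg ℕ.* ∣ x ∣ ℕ.^ F ∎)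
      where
      1≤x : w ℕ.< ∣ x ∣ → 1 ℕ.≤ ∣ x ∣
      1≤x y<x = ℕ.≤-trans (s≤s z≤n) y<x

    N≤H*w^e : Y₀ ℕ.≤ w → N ℕ.≤ H ℕ.* w ℕ.^ e
    N≤H*w^e Y₀≤y = begin
      N
        ≤⟨ ℕ.*-mono-≤ (ℕ.*-mono-≤ (proj₂ upper-P x w x≤w 1≤w) (proj₂ upper-Q x w x≤w 1≤w))
             (proj₂ upper-G y w ℕ.≤-refl 1≤w) ⟩
      proj₁ upper-P ℕ.* w ℕ.^ dP ℕ.* (proj₁ upper-Q ℕ.* w ℕ.^ dQ) ℕ.* (proj₁ upper-G ℕ.* w ℕ.^ dG)
        ≡⟨ identity (proj₁ upper-P) (proj₁ upper-Q) (proj₁ upper-G) (w ℕ.^ dP) (w ℕ.^ dQ) (w ℕ.^ dG) ⟩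
      H ℕ.* (w ℕ.^ dP ℕ.* w ℕ.^ dQ ℕ.* w ℕ.^ dG)
        ≡⟨ cong (H ℕ.*_) (trans (ℕ.^-distribˡ-+-* w (dP ℕ.+ dQ) dG)
             (cong (ℕ._* w ℕ.^ dG) (ℕ.^-distribˡ-+-* w dP dQ))) ⟨
      H ℕ.* w ℕ.^ (dP ℕ.+ dQ ℕ.+ dG)
        ≤⟨ ℕ.*-monoʳ-≤ H (ℕ.^-monoʳ-≤ w {{ℕ.>-nonZero 1≤w}} deg-PQG≤e) ⟩
      H ℕ.* w ℕ.^ e ∎
      where
      x≤w = ∣x∣≤∣y∣ Y₀≤y
      1≤w = ℕ.≤-trans (s≤s z≤n) Y₀≤y
      identity : ∀ h₁ h₂ h₃ u v t → h₁ ℕ.* u ℕ.* (h₂ ℕ.* v) ℕ.* (h₃ ℕ.* t) ≡ h₁ ℕ.* h₂ ℕ.* h₃ ℕ.* (u ℕ.* v ℕ.* t)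
      identity = ℕ.solve-∀

    -- Here s + 1 = E, that is ε = 1 / deg g. The number N is a multiple of P(x), Q(x) and G(y), so
    -- every prime divisor of A(x), B(x) or g(y) divides it.
    abc-bound : ¬ eval P x ≡ 0ℤ → ¬ eval Q x ≡ 0ℤ → ¬ eval G y ≡ 0ℤ →
      ∣ eval g y ∣ ℕ.^ E ℕ.≤ (D ℕ.* C) ℕ.^ E ℕ.* N ℕ.^ (E ℕ.+ 1)
    abc-bound Px≢0 Qx≢0 Gy≢0 = subst
      (λ Z → ∣ Z ∣ ℕ.^ E ℕ.≤ (D ℕ.* C) ℕ.^ E ℕ.* N ℕ.^ (E ℕ.+ 1)) Z≡gy
      (proj₂ (abc-bounded-gcd abc (suc e)) (eval A x) (eval B x) N D
        (∣PowerOf-≢0 {A} {P} A∣P x Px≢0) (∣PowerOf-≢0 {B} {Q} B∣Q x Qx≢0)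
        (λ Z≡0 → ∣PowerOf-≢0 {g} {G} g∣G y Gy≢0 (trans (sym Z≡gy) Z≡0))
        (ℕ.*-mono-≤ (ℕ.*-mono-≤ 1≤∣ Px≢0 ∣ 1≤∣ Qx≢0 ∣) 1≤∣ Gy≢0 ∣)
        (gcd≤D x)
        (λ pr r∣ → ℕ.∣m⇒∣m*n _ (ℕ.∣m⇒∣m*n _ (∣PowerOf-primes {A} {P} A∣P x pr r∣)))
        (λ pr r∣ → ℕ.∣m⇒∣m*n _ (ℕ.∣n⇒∣m*n ∣ eval P x ∣ (∣PowerOf-primes {B} {Q} B∣Q x pr r∣)))
        (λ pr r∣ → ℕ.∣n⇒∣m*n (∣ eval P x ∣ ℕ.* ∣ eval Q x ∣)
          (∣PowerOf-primes {g} {G} g∣G y pr (subst (λ Z → _ ℕ.∣ ∣ Z ∣) Z≡gy r∣))))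
      where
      Z≡gy : eval A x ℤ.+ eval B x ≡ eval g y
      Z≡gy = trans (sym (f≡A+B x)) fx≡gy

    generic : ¬ eval P x ≡ 0ℤ → ¬ eval Q x ≡ 0ℤ → ¬ eval G y ≡ 0ℤ → Y₀ ℕ.≤ w → w ℕ.≤ K
    generic Px≢0 Qx≢0 Gy≢0 Y₀≤y = cancel-powers w e K (ℕ.≤-trans (s≤s z≤n) Y₀≤y) (begin
      (w ℕ.^ suc e) ℕ.^ E
        ≡⟨ cong (ℕ._^ E) (ℕ.*-identityˡ (w ℕ.^ suc e)) ⟨
      (1 ℕ.* w ℕ.^ suc e) ℕ.^ E
        ≤⟨ ℕ.^-monoˡ-≤ E (proj₂ lower-g y (ℕ.≤-trans (ℕ.≤-trans (ℕ.m≤n+m _ _) (ℕ.n≤1+n _)) Y₀≤y)) ⟩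
      ∣ eval g y ∣ ℕ.^ E
        ≤⟨ abc-bound Px≢0 Qx≢0 Gy≢0 ⟩
      (D ℕ.* C) ℕ.^ E ℕ.* N ℕ.^ (E ℕ.+ 1)
        ≤⟨ ℕ.*-monoʳ-≤ ((D ℕ.* C) ℕ.^ E) (ℕ.^-monoˡ-≤ (E ℕ.+ 1) (N≤H*w^e Y₀≤y)) ⟩
      (D ℕ.* C) ℕ.^ E ℕ.* (H ℕ.* w ℕ.^ e) ℕ.^ (E ℕ.+ 1)
        ≡⟨ cong ((D ℕ.* C) ℕ.^ E ℕ.*_) (^-distribʳ-* H (w ℕ.^ e) (E ℕ.+ 1)) ⟩
      (D ℕ.* C) ℕ.^ E ℕ.* (H ℕ.^ (E ℕ.+ 1) ℕ.* (w ℕ.^ e) ℕ.^ (E ℕ.+ 1))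
        ≡⟨ ℕ.*-assoc ((D ℕ.* C) ℕ.^ E) (H ℕ.^ (E ℕ.+ 1)) ((w ℕ.^ e) ℕ.^ (E ℕ.+ 1)) ⟨
      K ℕ.* (w ℕ.^ e) ℕ.^ (E ℕ.+ 1) ∎)

  private
    roots-P = roots-bounded c₁≢0 top-P
    roots-Q = roots-bounded c₂≢0 top-Q
    roots-G = roots-bounded c₃≢0 top-G
    X₀ = suc (proj₁ roots-P ℕ.+ proj₁ roots-Q)
    -- At a root x of P or Q one has |x| ≤ X₀, so |f(x)|, and with it |g(y)|, is at most the value
    -- given here.
    small-g = sublevel-bounded b≢0 top-g (Hf ℕ.* X₀ ℕ.^ suc F)
    -- One summand for each case of `∣y∣-cases`; the successor meets the condition 1 ≤ w of
    -- `upper-bound`.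
    Y = suc (proj₁ roots-G ℕ.+ proj₁ small-g ℕ.+ Y₀ ℕ.+ K)
    small-f = sublevel-bounded a≢0 top-f (Hg ℕ.* Y ℕ.^ E)

  module _ {x y : ℤ} (fx≡gy : eval f x ≡ eval g y) where

    small-x : ∣ x ∣ ℕ.≤ X₀ → ∣ y ∣ ℕ.≤ proj₁ small-g
    small-x x≤X₀ = proj₂ small-g y
      (subst (ℕ._≤ Hf ℕ.* X₀ ℕ.^ suc F) (cong ∣_∣ fx≡gy) (proj₂ upper-f x X₀ x≤X₀ (s≤s z≤n)))

    -- The decisions are arguments because a with-abstraction here would normalise the huge term K.
    ∣y∣-cases : Dec (eval G y ≡ 0ℤ) → Dec (eval P x ≡ 0ℤ) → Dec (eval Q x ≡ 0ℤ) → Y₀ ℕ.≤ ∣ y ∣ ⊎ ∣ y ∣ ℕ.≤ Y₀ →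
      ∣ y ∣ ℕ.≤ proj₁ roots-G ⊎ ∣ y ∣ ℕ.≤ proj₁ small-g ⊎ ∣ y ∣ ℕ.≤ Y₀ ⊎ ∣ y ∣ ℕ.≤ K
    ∣y∣-cases (yes Gy≡0) _ _ _ = inj₁ (proj₂ roots-G y Gy≡0)
    ∣y∣-cases _ (yes Px≡0) _ _ = inj₂ (inj₁ (small-x
      (ℕ.≤-trans (proj₂ roots-P x Px≡0) (ℕ.m≤n⇒m≤1+n (ℕ.m≤m+n (proj₁ roots-P) (proj₁ roots-Q))))))
    ∣y∣-cases _ _ (yes Qx≡0) _ = inj₂ (inj₁ (small-x
      (ℕ.≤-trans (proj₂ roots-Q x Qx≡0) (ℕ.m≤n⇒m≤1+n (ℕ.m≤n+m (proj₁ roots-Q) (proj₁ roots-P))))))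
    ∣y∣-cases _ _ _ (inj₂ y≤Y₀) = inj₂ (inj₂ (inj₁ y≤Y₀))
    ∣y∣-cases (no Gy≢0) (no Px≢0) (no Qx≢0) (inj₁ Y₀≤y) =
      inj₂ (inj₂ (inj₂ (generic {x} {y} fx≡gy Px≢0 Qx≢0 Gy≢0 Y₀≤y)))

    ∣y∣≤Y : ∣ y ∣ ℕ.≤ Y
    ∣y∣≤Y = ℕ.m≤n⇒m≤1+n (≤-sum₄ (proj₁ roots-G) (proj₁ small-g) Y₀ K
      (∣y∣-cases (eval G y ℤ.≟ 0ℤ) (eval P x ℤ.≟ 0ℤ) (eval Q x ℤ.≟ 0ℤ) (ℕ.≤-total Y₀ ∣ y ∣)))

    ∣x∣≤X : ∣ x ∣ ℕ.≤ proj₁ small-f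
    ∣x∣≤X = proj₂ small-f x
      (subst (ℕ._≤ Hg ℕ.* Y ℕ.^ E) (sym (cong ∣_∣ fx≡gy)) (proj₂ upper-g y Y ∣y∣≤Y (s≤s z≤n)))

  finite : ∃[ S ] ((x y : ℤ) → eval f x ≡ eval g y → (x , y) ∈ S)
  finite = cartesianProduct (interval (proj₁ small-f)) (interval Y) , λ x y fx≡gy →
    ∈-cartesianProduct⁺ (∈-interval x (∣x∣≤X {x} {y} fx≡gy)) (∈-interval y (∣y∣≤Y {x} {y} fx≡gy))

-- With the sign moved into the second summand, both forms of the equation are treated as f = A + B.
signed : Sign → ℤ[x] → ℤ[x]
signed Sign.+ p = p
signed Sign.- p = - p

eval-± : ∀ ± p q x → eval (p ±[ ± ] q) x ≡ eval p x ℤ.+ eval (signed ± q) x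
eval-± Sign.+ p q x = eval-+ p q x
eval-± Sign.- p q x = eval-+ p (- q) x

signed-∣PowerOf : ∀ ± {p q} → p ∣PowerOf q → signed ± p ∣PowerOf q
signed-∣PowerOf Sign.+ p∣q = p∣q
signed-∣PowerOf Sign.- {p} (n , p∣q^n) = n , λ x →
  ℤ.∣-trans (ℤ.∣ᵤ⇒∣ (ℕ.∣-reflexive (trans (cong ∣_∣ (eval-neg p x)) (ℤ.∣-i∣≡∣i∣ (eval p x))))) (p∣q^n x)

top≤deg : ∀ {p d a} → ¬ a ≡ 0ℤ → Top p d a → d ℕ.≤ deg p
top≤deg {p} a≢0 (top c _) = ℕ.≮⇒≥ λ deg<d → a≢0 (trans (sym c) (Top.above (top-deg p) deg<d))

>0⇒≢0 : ∀ {i} → 0ℤ ℤ.< i → ¬ i ≡ 0ℤ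
>0⇒≢0 0<i refl = ℤ.<-irrefl refl 0<i

theorem1p4 : (l m n : ℕ) → 0 ℕ.< l → 0 ℕ.< m → 0 ℕ.< n →
    (f₁ : Vector ℤ[x] l) (f₂ : Vector ℤ[x] m) (gs : Vector ℤ[x] n) →
    (α : Vector ℕ l) (β : Vector ℕ m) (γ : Vector ℕ n) →
    (∀ i → 0 ℕ.< α i) → (∀ i → 0 ℕ.< β i) → (∀ i → 0 ℕ.< γ i) →
    (± : Sign) →
    let f = powerProduct f₁ α ±[ ± ] powerProduct f₂ β
        g = powerProduct gs γ
    in
    deg g ℕ.< deg f →
    1 ℕ.+ deg (product f₁ * product f₂ * product gs) ℕ.< deg g →
    Coprime (product f₁) (product f₂) →
    0ℤ ℤ.< leadingCoeff (product f₁) →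
    0ℤ ℤ.< leadingCoeff (product f₂) →
    0ℤ ℤ.< leadingCoeff (product gs) →
    ABC-Conjecture →
    ∃[ S ] ((x y : ℤ) → eval f x ≡ eval g y → (x , y) ∈ S)
theorem1p4 _ _ _ _ _ _ f₁ f₂ gs α β γ _ _ _ ± deg-g<deg-f deg-PQG<deg-g coprime 0<P 0<Q 0<G abc =
  conclude (deg f) (deg g) refl refl deg-g<deg-f deg-PQG<deg-g
  where
  f = powerProduct f₁ α ±[ ± ] powerProduct f₂ β
  g = powerProduct gs γ
  P = product f₁
  Q = product f₂
  G = product gs

  -- The leading coefficients are positive, so the degrees of the factors add up, and the hypothesis
  -- on deg (P Q G) bounds the sum dP + dQ + dG in `Solutions`.
  P*Q*G-top : Top (P * Q * G) (deg P ℕ.+ deg Q ℕ.+ deg G) (leadingCoeff P ℤ.* leadingCoeff Q ℤ.* leadingCoeff G)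
  P*Q*G-top = top-* (top-* (top-deg P) (top-deg Q)) (top-deg G)

  lc≢0 : ¬ leadingCoeff P ℤ.* leadingCoeff Q ℤ.* leadingCoeff G ≡ 0ℤ
  lc≢0 eq = [ (λ eq′ → [ >0⇒≢0 0<P , >0⇒≢0 0<Q ]′ (ℤ.i*j≡0⇒i≡0∨j≡0 (leadingCoeff P) eq′)) , >0⇒≢0 0<G ]′
    (ℤ.i*j≡0⇒i≡0∨j≡0 (leadingCoeff P ℤ.* leadingCoeff Q) eq)

  -- The degrees are passed as variables with equations, so that matching on the inequalities can
  -- expose the forms F + 1 and e + 2.
  conclude : ∀ df dg → df ≡ deg f → dg ≡ deg g → dg ℕ.< df → 1 ℕ.+ deg (P * Q * G) ℕ.< dg →
    ∃[ S ] ((x y : ℤ) → eval f x ≡ eval g y → (x , y) ∈ S)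
  conclude (suc F) (suc (suc e)) eqf eqg (s≤s E≤F) (s≤s (s≤s degPQG≤e)) = Solutions.finite
    {P} {Q} {G} {powerProduct f₁ α} {signed ± (powerProduct f₂ β)} {f} {g}
    (leadingCoeff≢0 f (subst (0 ℕ.<_) eqf (s≤s z≤n))) (subst (λ d → Top f d (leadingCoeff f)) (sym eqf) (top-deg f))
    (leadingCoeff≢0 g (subst (0 ℕ.<_) eqg (s≤s z≤n))) (subst (λ d → Top g d (leadingCoeff g)) (sym eqg) (top-deg g))
    (>0⇒≢0 0<P) (top-deg P) (>0⇒≢0 0<Q) (top-deg Q) (>0⇒≢0 0<G) (top-deg G)
    E≤F (ℕ.≤-trans (top≤deg lc≢0 P*Q*G-top) degPQG≤e)
    (powerProduct-∣ f₁ α) (signed-∣PowerOf ± {powerProduct f₂ β} {Q} (powerProduct-∣ f₂ β)) (powerProduct-∣ gs γ)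
    (eval-± ± (powerProduct f₁ α) (powerProduct f₂ β)) coprime abc
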